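{- Let $d\ge 1$ and let $p,q$ be monic polynomials of degree $d$ with complex coefficients. Then for every $n=1,\dots,d$, \[ \kappa_n^d(p \boxtimes_d q )=\frac{(-1)^{n-1}}{d^{n+1} (n-1)!} \sum_{\substack{ \sigma, \tau\in P(n) \\ \sigma\vee \tau=1_n }} d^{|\sigma|+|\tau|}\mu(0_n,\sigma)\mu(0_n,\tau) \kappa_\sigma^d(p ) \kappa^d_\tau(q ) \] and \[ m_n(p \boxtimes_d q )=\frac{(-1)^{n-1}}{d^{n+1} (n-1)!} \sum_{\substack{ \sigma, \tau\in P(n) \\ \sigma\vee \tau=1_n }} d^{|\sigma|+|\tau|}\mu(0_n,\sigma)\mu(0_n,\tau) \kappa_\sigma^d(p ) m_\tau(q ). \]
   Context: For a monic polynomial $p$ of degree $d$ with roots $\lambda_1,\dots,\lambda_d$ write $p(x)=\sum_{i=0}^d (-1)^i a_i^p x^{d-i}$, so $a_0^p=1$ and $a_i^p$ is the $i$-th elementary symmetric polynomial of the roots. The moments of $p$ are $m_n(p)=\frac1d\sum_{i=1}^d\lambda_i^n$. The finite free multiplicative convolution $p\boxtimes_d q$ is the monic polynomial of degree $d$ with $a_k^{p\boxtimes_d q}=a_k^pa_k^q/\binom{d}{k}$ for $k=0,\dots,d$. Let $(d)_k=d(d-1)\cdots(d-k+1)$. $P(n)$ is the lattice of set partitions of $\{1,\dots,n\}$ ordered by refinement ($\pi\le\sigma$ if every block of $\pi$ is contained in a block of $\sigma$), with minimum $0_n$ (all singletons), maximum $1_n$ (one block) and join $\vee$; $|\pi|$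 denotes the number of blocks of $\pi$, and $\mu$ is the Möbius function of $P(n)$, explicitly $\mu(0_n,\pi)=(-1)^{n-|\pi|}\prod_{V\in\pi}(|V|-1)!$. For a sequence $(u_j)$ and $\pi\in P(n)$ set $u_\pi=\prod_{V\in\pi}u_{|V|}$; for $\pi\in P(n)$ also set $a^p_\pi=\prod_{V\in\pi}a^p_{|V|}$, $N!_\pi=\prod_{V\in\pi}|V|!$ and $(d)_\pi=\prod_{V\in\pi}(d)_{|V|}$. The finite free cumulants of $p$ are defined for $n=1,\dots,d$ by \[\kappa_n^d(p)=\frac{(-d)^n}{d(n-1)!}\sum_{\pi\in P(n)}(-1)^{|\pi|}\frac{N!_\pi\, a_\pi^p\,(|\pi|-1)!}{(d)_\pi},\] and $\kappa^d_\sigma(p)=\prod_{V\in\sigma}\kappa^d_{|V|}(p)$, $m_\tau(q)=\prod_{V\in\tau}m_{|V|}(q)$. -}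

module Defs where

open import Level using (Level; _⊔_)
open import Data.Nat as ℕ using (ℕ; zero; suc; _∸_; _≡ᵇ_; _!)
open import Data.Nat.Combinatorics using (_P_; _C_)
open import Data.Bool using (Bool; true; false; _∧_; _∨_; not; if_then_else_)
open import Data.List using (List; []; _∷_; map; foldr; zip; concatMap; upTo; length)
open import Data.Vec using (Vec; toList)
open import Data.Product using (_×_; _,_)
open import Relation.Nullary using (¬_)
open import Algebra.Bundles using (CommutativeRing)

-- Fields of characteristic zero (stand-in for ℂ).
-- `inv` is total, but only required to be an inverse on nonzero elements.

ιR : {c ℓ : Level} (R : CommutativeRing c ℓ) → ℕ → CommutativeRing.Carrier R
ιR R zero    = CommutativeRing.0# R
ιR R (suc n) = CommutativeRing._+_ R (CommutativeRing.1# R) (ιR R n)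

record CharZeroField (c ℓ : Level) : Set (Level.suc (c ⊔ ℓ)) where
  field
    commutativeRing : CommutativeRing c ℓ
  open CommutativeRing commutativeRing public
  field
    inv         : Carrier → Carrier
    inverseʳ    : ∀ x → ¬ (x ≈ 0#) → (x * inv x) ≈ 1#
    charZero    : ∀ n → ¬ (ιR commutativeRing (suc n) ≈ 0#)

  ι : ℕ → Carrier
  ι = ιR commutativeRing

-- Set partitions of {1,…,n}, encoded as restricted growth strings:
-- a list s of length n of block labels with s₀ = 0 and each label at most
-- one more than the maximum of the previous labels.  Each set partition
-- has exactly one such encoding (blocks labelled by order of first element).

-- partsFrom n m : all continuations of length n when m labels are used so far
partsFrom : ℕ → ℕ → List (List ℕ)
partsFrom zero    m = [] ∷ []
partsFrom (suc n) m =
  concatMap (λ j → map (j ∷_) (partsFrom n (if j ≡ᵇ m then suc m else m)))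
            (upTo (suc m))

P : ℕ → List (List ℕ)
P n = partsFrom n 0

nBlocks : List ℕ → ℕ
nBlocks []       = 0
nBlocks (x ∷ xs) = suc (foldr ℕ._⊔_ x xs)

count : ℕ → List ℕ → ℕ
count j []       = 0
count j (x ∷ xs) = (if j ≡ᵇ x then 1 else 0) ℕ.+ count j xs

blockSizes : List ℕ → List ℕ
blockSizes s = map (λ j → count j s) (upTo (nBlocks s))

allB : {A : Set} → (A → Bool) → List A → Bool
allB f = foldr (λ x b → f x ∧ b) true

_≤ᴾ_ : List ℕ → List ℕ → Bool
π ≤ᴾ σ = allB (λ { (a , b) → allB (λ { (c , e) → not (a ≡ᵇ c) ∨ (b ≡ᵇ e) }) ps }) ps
  where ps = zip π σ

isOne : List ℕ → Bool
isOne = allB (λ x → x ≡ᵇ 0)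

joinIsOne : ℕ → List ℕ → List ℕ → Bool
joinIsOne n σ τ = allB (λ ρ → not ((σ ≤ᴾ ρ) ∧ (τ ≤ᴾ ρ)) ∨ isOne ρ) (P n)

prodℕ : List ℕ → ℕ
prodℕ = foldr ℕ._*_ 1

-- Finite free cumulants, moments etc. over a characteristic-zero field.
-- A monic polynomial of degree d is given by its vector of roots
-- λ₁,…,λ_d, i.e. p(x) = ∏ (x - λᵢ), so a_k^p = e_k(λ).

module _ {c ℓ : Level} (F : CharZeroField c ℓ) where
  open CharZeroField F

  Σ : List Carrier → Carrier
  Σ = foldr _+_ 0#

  Π : List Carrier → Carrier
  Π = foldr _*_ 1#

  _^_ : Carrier → ℕ → Carrier
  x ^ zero  = 1#
  x ^ suc k = x * (x ^ k)

  -- division by a natural number (nonzero in all uses below)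
  _/ℕ_ : Carrier → ℕ → Carrier
  x /ℕ k = x * inv (ι k)

  esymL : List Carrier → ℕ → Carrier
  esymL []       zero    = 1#
  esymL []       (suc k) = 0#
  esymL (x ∷ xs) zero    = 1#
  esymL (x ∷ xs) (suc k) = esymL xs (suc k) + x * esymL xs k

  coeff : {d : ℕ} → Vec Carrier d → ℕ → Carrier
  coeff λs k = esymL (toList λs) k

  coeffπ : {d : ℕ} → Vec Carrier d → List ℕ → Carrier
  coeffπ λs π = Π (map (coeff λs) (blockSizes π))

  moment : {d : ℕ} → Vec Carrier d → ℕ → Carrier
  moment {d} λs n = Σ (map (λ x → x ^ n) (toList λs)) /ℕ d

  kappa : {d : ℕ} → Vec Carrier d → ℕ → Carrier
  kappa {d} λs n =
    (((- ι d) ^ n) /ℕ (d ℕ.* ((n ∸ 1) !))) *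
    Σ (map (λ π → ((((- 1#) ^ nBlocks π) * ι (prodℕ (map _! (blockSizes π))))
                   * coeffπ λs π * ι ((nBlocks π ∸ 1) !))
                  /ℕ prodℕ (map (d P_) (blockSizes π)))
           (P n))

  kappaπ : {d : ℕ} → Vec Carrier d → List ℕ → Carrier
  kappaπ λs σ = Π (map (kappa λs) (blockSizes σ))

  momentπ : {d : ℕ} → Vec Carrier d → List ℕ → Carrier
  momentπ λs τ = Π (map (moment λs) (blockSizes τ))

  möbius : ℕ → List ℕ → Carrier
  möbius n π = ((- 1#) ^ (n ∸ nBlocks π)) * ι (prodℕ (map (λ k → (k ∸ 1) !) (blockSizes π)))

  IsBoxtimesRoots : {d : ℕ} → Vec Carrier d → Vec Carrier d → Vec Carrier d → Set ℓ
  IsBoxtimesRoots {d} λs μs νs =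
    ∀ k → k ℕ.≤ d → coeff νs k ≈ ((coeff λs k * coeff μs k) /ℕ (d C k))

  rhs : {d : ℕ} → Vec Carrier d → (List ℕ → Carrier) → ℕ → Carrier
  rhs {d} λs fτ n =
    (((- 1#) ^ (n ∸ 1)) /ℕ ((d ℕ.^ (n ℕ.+ 1)) ℕ.* ((n ∸ 1) !))) *
    Σ (concatMap (λ σ → concatMap (λ τ →
         if joinIsOne n σ τ
         then ((ι d ^ (nBlocks σ ℕ.+ nBlocks τ)) * möbius n σ * möbius n τ
                * kappaπ λs σ * fτ τ) ∷ []
         else []) (P n)) (P n))

{-# OPTIONS --safe #-}
-- Put α_k = k! a_k / (d)_k and let cₙ(α) = ∑_π μ(π,1ₙ) α_π be its classical cumulants. Then
-- d^|σ| μ(0ₙ,σ) κ_σ = dⁿ c_σ(α), the finite free convolution is α^{p⊠q} = α^p α^q, and by Newton's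
-- identities the sequence k! a_k has cumulants (-1)^(n-1) (n-1)! d mₙ. Both formulas thus become
-- the Leonov–Shiryaev formula for the cumulants of a product,
--   ∑_{σ∨τ=1ₙ} c_σ c′_τ = ∑_ρ μ(ρ,1ₙ) E_ρ E′_ρ,   Eₙ = ∑_π c_π, E′ₙ = ∑_π c′_π.
-- It follows by expanding the indicator of σ∨τ = 1ₙ as ∑_{ρ≥σ,τ} μ(ρ,1ₙ) and using
-- ∑_{σ≤ρ} c_σ = E_ρ.
module Submission where

-- Since `P n` is generated letter by letter, every sum over partitions is evaluated by removing the
-- first element. This forces a generalisation: `m` blocks are already open and block j carries a
-- sequence `f j` of its own. An element that joins block j differentiates `f j`, so choosing its
-- block is the Leibniz rule, and sums over partitions turn into binomial convolutions of
-- exponential generating functions. Exponentials and logarithms are compared through the equation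
-- y′ = b y, with the reciprocal 1/A realised as one more partition sum. Möbius inversion comes down
-- to the recurrence m μₘ + μₘ₊₁ = 0 in the number of blocks. The bound n ≤ d keeps every (d)_k
-- nonzero and makes the coefficient formula for ⊠ available at all block sizes.

open import Defs
open import Level using (Level)
open import Data.Bool using (Bool; true; false; _∧_; _∨_; not; T; if_then_else_)
import Data.Bool.Properties as Boolₚ
open import Data.Empty using (⊥-elim)
open import Data.List using (List; []; _∷_; _++_; length; upTo; map; foldr; zip; filter; concatMap; cartesianProduct)
import Data.List.Properties as Listₚ
open import Data.List.Membership.Propositional using (_∈_; find)
open import Data.List.Membership.Propositional.Properties
  using (∈-upTo⁺; ∈-upTo⁻; ∈-filter⁺; ∈-filter⁻; ∈-cartesianProduct⁺; ∈-cartesianProduct⁻; ∈-concatMap⁻; ∈-map⁻)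
open import Data.List.Relation.Unary.All as All using (All; []; _∷_)
import Data.List.Relation.Unary.All.Properties as Allₚ
open import Data.List.Relation.Unary.Any as Any using (Any; here; there; any?)
open import Data.Maybe using (Maybe; just; nothing)
open import Data.Maybe.Properties using (just-injective)
open import Data.Nat as ℕ using (ℕ; zero; suc; _≤_; _<_; _∸_; z≤n; s≤s; _!; _≡ᵇ_; _⊔_; NonZero)
open import Data.Nat.Combinatorics
  using (_C_; nPk≡n!/[n∸k]!; nCk≡n!/k![n-k]!; [n∸k]!k!∣n!) renaming (_P_ to _↓_)
open import Data.Nat.Divisibility using (_∣_; m≤n⇒m!∣n!)
open import Data.Nat.DivMod using (m/n*n≡m)
open import Data.Nat.ListAction using (sum)
open import Data.Nat.ListAction.Properties using (sum-++)
import Data.Nat.Properties as ℕₚ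
open import Data.Product using (_×_; _,_; proj₁; proj₂; ∃)
open import Data.Unit using (tt)
open import Data.Vec using (Vec; toList)
open import Function using (_∘_; id; mk⇔)
open import Relation.Nullary using (¬_; Dec; yes; no; ¬?; _×-dec_)
open import Relation.Binary.PropositionalEquality as ≡ using (_≡_; _≢_; refl)

-- Partitions as restricted growth strings

≡ᵇ-refl : ∀ n → (n ≡ᵇ n) ≡ true
≡ᵇ-refl zero    = refl
≡ᵇ-refl (suc n) = ≡ᵇ-refl n

≢⇒≡ᵇ-false : ∀ {m n} → m ≢ n → (m ≡ᵇ n) ≡ false
≢⇒≡ᵇ-false {zero}  {zero}  p = ⊥-elim (p refl)
≢⇒≡ᵇ-false {zero}  {suc n} p = refl
≢⇒≡ᵇ-false {suc m} {zero}  p = refl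
≢⇒≡ᵇ-false {suc m} {suc n} p = ≢⇒≡ᵇ-false (p ∘ ≡.cong suc)

-- `nBlocks` folds from the head as base value; exchanging base and next label through the fold
-- gives a recursion that holds for an empty tail too.
nBlocks-∷ : ∀ x s → nBlocks (x ∷ s) ≡ suc x ⊔ nBlocks s
nBlocks-∷ x []      = refl
nBlocks-∷ x (y ∷ s) = ≡.cong suc (go x y s)
  where
  go : ∀ x y s → y ⊔ foldr _⊔_ x s ≡ x ⊔ foldr _⊔_ y s
  go x y []      = ℕₚ.⊔-comm y x
  go x y (z ∷ s) = begin
    y ⊔ (z ⊔ foldr _⊔_ x s)  ≡⟨ ℕₚ.⊔-comm y _ ⟩
    (z ⊔ foldr _⊔_ x s) ⊔ y  ≡⟨ ℕₚ.⊔-assoc z _ y ⟩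
    z ⊔ (foldr _⊔_ x s ⊔ y)  ≡⟨ ≡.cong (z ⊔_) (≡.trans (ℕₚ.⊔-comm _ y) (go x y s)) ⟩
    z ⊔ (x ⊔ foldr _⊔_ y s)  ≡⟨ ℕₚ.⊔-assoc z x _ ⟨
    (z ⊔ x) ⊔ foldr _⊔_ y s  ≡⟨ ≡.cong (_⊔ _) (ℕₚ.⊔-comm z x) ⟩
    (x ⊔ z) ⊔ foldr _⊔_ y s  ≡⟨ ℕₚ.⊔-assoc x z _ ⟩
    x ⊔ (z ⊔ foldr _⊔_ y s)  ∎
    where open ≡.≡-Reasoning

-- Here and below, `m ⊔ nBlocks s` is the final number of blocks when `s` continues a string that
-- has used the labels below `m`.
⊔-nBlocks-∷ : ∀ m x s → m ⊔ nBlocks (x ∷ s) ≡ (m ⊔ suc x) ⊔ nBlocks s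
⊔-nBlocks-∷ m x s = ≡.trans (≡.cong (m ⊔_) (nBlocks-∷ x s)) (≡.sym (ℕₚ.⊔-assoc m (suc x) (nBlocks s)))

⊔-nBlocks-old : ∀ {m x} s → x ℕ.< m → m ⊔ nBlocks (x ∷ s) ≡ m ⊔ nBlocks s
⊔-nBlocks-old {m} {x} s lt = ≡.trans (⊔-nBlocks-∷ m x s) (≡.cong (_⊔ nBlocks s) (ℕₚ.m≥n⇒m⊔n≡m lt))

⊔-nBlocks-new : ∀ m s → m ⊔ nBlocks (m ∷ s) ≡ suc m ⊔ nBlocks s
⊔-nBlocks-new m s = ≡.trans (⊔-nBlocks-∷ m m s) (≡.cong (_⊔ nBlocks s) (ℕₚ.m≤n⇒m⊔n≡n (ℕₚ.n≤1+n m)))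

Dict : Set
Dict = ℕ → Maybe ℕ

upd : Dict → ℕ → ℕ → Dict
upd φ x y i = if i ≡ᵇ x then just y else φ i

upd-≡ : ∀ φ x y → upd φ x y x ≡ just y
upd-≡ φ x y rewrite ≡ᵇ-refl x = refl

upd-≢ : ∀ φ {x i} y → i ≢ x → upd φ x y i ≡ φ i
upd-≢ φ y i≢x rewrite ≢⇒≡ᵇ-false i≢x = refl

match : Maybe ℕ → ℕ → Bool
match nothing  v = true
match (just u) v = u ≡ᵇ v

has : Maybe ℕ → ℕ → Bool
has nothing  v = false
has (just u) v = u ≡ᵇ v

-- Every label of s always meets the same label of r, where φ records the pairs met so far.
compatible : Dict → List ℕ → List ℕ → Bool
compatible φ []      _       = true
compatible φ (_ ∷ _) []      = true
compatible φ (x ∷ s) (y ∷ r) = match (φ x) y ∧ compatible (upd φ x y) s r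

≡ᵇ-true⇒≡ : ∀ {m n} → (m ≡ᵇ n) ≡ true → m ≡ n
≡ᵇ-true⇒≡ {m} {n} e = ℕₚ.≡ᵇ⇒≡ m n (≡.subst T (≡.sym e) tt)

≡⇒≡ᵇ-true : ∀ {m n} → m ≡ n → (m ≡ᵇ n) ≡ true
≡⇒≡ᵇ-true {m} refl = ≡ᵇ-refl m

∧-true⁻ : ∀ {a b} → a ∧ b ≡ true → a ≡ true × b ≡ true
∧-true⁻ {true} {true} refl = refl , refl

∧-true⁺ : ∀ {a b} → a ≡ true → b ≡ true → a ∧ b ≡ true
∧-true⁺ refl refl = refl

implies⁻ : ∀ {a b} → not a ∨ b ≡ true → a ≡ true → b ≡ true
implies⁻ e refl = e

implies⁺ : ∀ {a b} → (a ≡ true → b ≡ true) → not a ∨ b ≡ true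
implies⁺ {true}  f = f refl
implies⁺ {false} f = refl

module _ {A : Set} {f : A → Bool} where
  allB⁻ : ∀ {xs} → allB f xs ≡ true → ∀ {x} → x ∈ xs → f x ≡ true
  allB⁻ {x ∷ xs} e (here refl) = proj₁ (∧-true⁻ e)
  allB⁻ {x ∷ xs} e (there x∈) = allB⁻ {xs} (proj₂ (∧-true⁻ {f x} e)) x∈

  allB⁺ : ∀ {xs} → (∀ {x} → x ∈ xs → f x ≡ true) → allB f xs ≡ true
  allB⁺ {[]}     p = refl
  allB⁺ {x ∷ xs} p = ∧-true⁺ (p (here refl)) (allB⁺ (p ∘ there))

  allB-false : ∀ xs → allB f xs ≡ false → ∃ λ x → x ∈ xs × f x ≡ false
  allB-false (x ∷ xs) e with f x in fx
  ... | false = x , here refl , fx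
  ... | true  = let y , y∈ , fy = allB-false xs e in y , there y∈ , fy

Functional : List (ℕ × ℕ) → Set
Functional ps = ∀ {p q} → p ∈ ps → q ∈ ps → proj₁ p ≡ proj₁ q → proj₂ p ≡ proj₂ q

≤ᴾ⇒Functional : ∀ π σ → π ≤ᴾ σ ≡ true → Functional (zip π σ)
≤ᴾ⇒Functional π σ e {p} {q} p∈ q∈ eq = ≡ᵇ-true⇒≡
  (implies⁻ {proj₁ p ≡ᵇ proj₁ q} (allB⁻ (allB⁻ {xs = zip π σ} e p∈) q∈) (≡⇒≡ᵇ-true eq))

Functional⇒≤ᴾ : ∀ π σ → Functional (zip π σ) → π ≤ᴾ σ ≡ true
Functional⇒≤ᴾ π σ fn = allB⁺ {xs = zip π σ} λ {p} p∈ → allB⁺ {xs = zip π σ} λ {q} q∈ →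
  implies⁺ {proj₁ p ≡ᵇ proj₁ q} (λ e → ≡⇒≡ᵇ-true (fn p∈ q∈ (≡ᵇ-true⇒≡ e)))

Extends : Dict → List (ℕ × ℕ) → Set
Extends φ ps = ∀ {x y u} → (x , y) ∈ ps → φ x ≡ just u → u ≡ y

compatible⁻ : ∀ φ s r → compatible φ s r ≡ true → Extends φ (zip s r) × Functional (zip s r)
compatible⁻ φ []      _       e = (λ ()) , (λ ())
compatible⁻ φ (_ ∷ _) []      e = (λ ()) , (λ ())
compatible⁻ φ (x ∷ s) (y ∷ r) e with ∧-true⁻ {match (φ x) y} e
... | e₁ , e₂ with compatible⁻ (upd φ x y) s r e₂
... | ext′ , fn′ = ext , fn
  where
  same : ∀ {q} → q ∈ zip s r → x ≡ proj₁ q → y ≡ proj₂ q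
  same {q} q∈ refl = ext′ q∈ (upd-≡ φ x y)
  ext : Extends φ ((x , y) ∷ zip s r)
  ext (here refl) φx with φ x
  ext (here refl) refl | just u = ≡ᵇ-true⇒≡ e₁
  ext {x′} {y′} {u} (there p∈) φx with x′ ℕ.≟ x
  ... | no x′≢x = ext′ p∈ (≡.trans (upd-≢ φ y x′≢x) φx)
  ... | yes refl = ≡.trans (ext (here refl) φx) (same p∈ refl)
  fn : Functional ((x , y) ∷ zip s r)
  fn (here refl) (here refl) eq = refl
  fn (here refl) (there q∈)  eq = same q∈ eq
  fn (there p∈)  (here refl) eq = ≡.sym (same p∈ (≡.sym eq))
  fn (there p∈)  (there q∈)  eq = fn′ p∈ q∈ eq

compatible⁺ : ∀ φ s r → Extends φ (zip s r) → Functional (zip s r) → compatible φ s r ≡ true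
compatible⁺ φ []      _       ext fn = refl
compatible⁺ φ (_ ∷ _) []      ext fn = refl
compatible⁺ φ (x ∷ s) (y ∷ r) ext fn = ∧-true⁺ hd
  (compatible⁺ (upd φ x y) s r ext′ (λ p∈ q∈ → fn (there p∈) (there q∈)))
  where
  hd : match (φ x) y ≡ true
  hd with φ x in φx
  ... | nothing = refl
  ... | just u  = ≡⇒≡ᵇ-true (ext (here refl) φx)
  ext′ : Extends (upd φ x y) (zip s r)
  ext′ {x′} p∈ e with x′ ℕ.≟ x
  ... | no x′≢x = ext (there p∈) (≡.trans (≡.sym (upd-≢ φ y x′≢x)) e)
  ... | yes refl = ≡.trans (just-injective (≡.trans (≡.sym e) (upd-≡ φ x y))) (fn (here refl) (there p∈) refl)

∅ : Dict
∅ _ = nothing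

-- `_≤ᴾ_` compares all pairs of positions at once; `compatible` reads both strings from left to
-- right, the form that a recursion along `partsFrom` can follow.
≤ᴾ-compatible : ∀ s r → s ≤ᴾ r ≡ compatible ∅ s r
≤ᴾ-compatible s r = Boolₚ.⇔→≡ {z = true} (mk⇔
  (λ e → compatible⁺ ∅ s r (λ _ ()) (≤ᴾ⇒Functional s r e))
  (λ e → Functional⇒≤ᴾ s r (proj₂ (compatible⁻ ∅ s r e))))

-- Joins of partitions, by positions

at : List ℕ → ℕ → ℕ
at []       _       = 0
at (x ∷ xs) zero    = x
at (x ∷ xs) (suc i) = at xs i

at-∈-zip : ∀ {n} s r → length s ≡ n → length r ≡ n → ∀ {i} → i < n → (at s i , at r i) ∈ zip s r
at-∈-zip (x ∷ s) (y ∷ r) refl lr {zero}  _        = here refl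
at-∈-zip (x ∷ s) (y ∷ r) refl lr {suc i} (s≤s lt) = there (at-∈-zip s r refl (ℕₚ.suc-injective lr) lt)
at-∈-zip [] _ refl _ ()

∈-zip-at : ∀ {n} s r → length s ≡ n → length r ≡ n → ∀ {p} → p ∈ zip s r →
           ∃ λ i → i < n × p ≡ (at s i , at r i)
∈-zip-at (x ∷ s) (y ∷ r) refl lr (here refl) = 0 , s≤s z≤n , refl
∈-zip-at (x ∷ s) (y ∷ r) refl lr (there p∈) =
  let i , lt , e = ∈-zip-at s r refl (ℕₚ.suc-injective lr) p∈ in suc i , s≤s lt , e

at-map : ∀ h s {i} → i < length s → at (map h s) i ≡ h (at s i)
at-map h (x ∷ s) {zero}  _        = refl
at-map h (x ∷ s) {suc i} (s≤s lt) = at-map h s lt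

module _ {n : ℕ} where
  Refines : List ℕ → List ℕ → Set
  Refines s r = ∀ {i j} → i < n → j < n → at s i ≡ at s j → at r i ≡ at r j

  ≤ᴾ⇒Refines : ∀ s r → length s ≡ n → length r ≡ n → s ≤ᴾ r ≡ true → Refines s r
  ≤ᴾ⇒Refines s r ls lr e i< j< = ≤ᴾ⇒Functional s r e (at-∈-zip s r ls lr i<) (at-∈-zip s r ls lr j<)

  Refines⇒≤ᴾ : ∀ s r → length s ≡ n → length r ≡ n → Refines s r → s ≤ᴾ r ≡ true
  Refines⇒≤ᴾ s r ls lr ref = Functional⇒≤ᴾ s r fn
    where
    fn : Functional (zip s r)
    fn p∈ q∈ eq with ∈-zip-at s r ls lr p∈ | ∈-zip-at s r ls lr q∈
    ... | i , i< , refl | j , j< , refl = ref i< j< eq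

  -- Identifies the labels that σ has at the two positions of each pair in the list.
  relabel : List ℕ → List (ℕ × ℕ) → ℕ → ℕ
  relabel σ []             x = x
  relabel σ ((i , j) ∷ ps) x =
    if h x ≡ᵇ h (at σ j) then h (at σ i) else h x
    where h = relabel σ ps

  -- Each merging step only applies a further function to the values of the previous relabelling, so
  -- identifications made earlier persist.
  relabel-merges : ∀ σ ps {p} → p ∈ ps → relabel σ ps (at σ (proj₁ p)) ≡ relabel σ ps (at σ (proj₂ p))
  relabel-merges σ ((i , j) ∷ ps) (here refl)
    rewrite ≡ᵇ-refl (relabel σ ps (at σ j)) with relabel σ ps (at σ i) ≡ᵇ relabel σ ps (at σ j)
  ... | true  = refl
  ... | false = refl
  relabel-merges σ (_ ∷ ps) {k , l} (there p∈) rewrite relabel-merges σ ps p∈ = refl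

  -- A step moves the class of position b into that of a, and `r` does not separate a from b. The
  -- four cases record which of i and j lie in the class of b.
  relabel-least : ∀ σ ps r → (∀ {i j} → (i , j) ∈ ps → i < n × j < n × at r i ≡ at r j) → Refines σ r →
    ∀ {i j} → i < n → j < n → relabel σ ps (at σ i) ≡ relabel σ ps (at σ j) → at r i ≡ at r j
  relabel-least σ []             r _  ref i< j< e = ref i< j< e
  relabel-least σ ((a , b) ∷ ps) r rel ref {i} {j} i< j< e
    with rel (here refl) | relabel-least σ ps r (rel ∘ there) ref
  ... | a< , b< , ra≡rb | ih
    with relabel σ ps (at σ i) ≡ᵇ relabel σ ps (at σ b) in ei | relabel σ ps (at σ j) ≡ᵇ relabel σ ps (at σ b) in ej
  ... | true  | true  = ≡.trans (ih i< b< (≡ᵇ-true⇒≡ ei)) (≡.sym (ih j< b< (≡ᵇ-true⇒≡ ej)))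
  ... | true  | false = ≡.trans (ih i< b< (≡ᵇ-true⇒≡ ei)) (≡.trans (≡.sym ra≡rb) (ih a< j< e))
  ... | false | true  = ≡.trans (ih i< a< e) (≡.trans ra≡rb (≡.sym (ih j< b< (≡ᵇ-true⇒≡ ej))))
  ... | false | false = ih i< j< e

  -- The labelling t has the blocks of σ ∨ τ as fibres, but need not be a restricted growth string.
  join : ∀ σ τ → length σ ≡ n → length τ ≡ n → ∃ λ t → length t ≡ n ×
         (∀ r → length r ≡ n → (σ ≤ᴾ r) ∧ (τ ≤ᴾ r) ≡ t ≤ᴾ r)
  join σ τ lσ lτ = t , lt , λ r lr → Boolₚ.⇔→≡ {z = true} (mk⇔ (to r lr) (from r lr))
    where
    -- All pairs of positions in a common block of τ: identifying their σ-labels generates σ ∨ τ.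
    ps : List (ℕ × ℕ)
    ps = filter (λ p → at τ (proj₁ p) ℕ.≟ at τ (proj₂ p)) (cartesianProduct (upTo n) (upTo n))
    t : List ℕ
    t = map (relabel σ ps) σ
    lt : length t ≡ n
    lt = ≡.trans (Listₚ.length-map _ σ) lσ
    at-t : ∀ {i} → i < n → at t i ≡ relabel σ ps (at σ i)
    at-t i< = at-map (relabel σ ps) σ (≡.subst (_ <_) (≡.sym lσ) i<)
    to : ∀ r → length r ≡ n → (σ ≤ᴾ r) ∧ (τ ≤ᴾ r) ≡ true → t ≤ᴾ r ≡ true
    to r lr e = Refines⇒≤ᴾ t r lt lr λ i< j< e′ →
      relabel-least σ ps r rel (≤ᴾ⇒Refines σ r lσ lr (proj₁ e₁₂)) i< j<
        (≡.trans (≡.sym (at-t i<)) (≡.trans e′ (at-t j<)))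
      where
      e₁₂ = ∧-true⁻ {σ ≤ᴾ r} e
      rel : ∀ {i j} → (i , j) ∈ ps → i < n × j < n × at r i ≡ at r j
      rel p∈ with ∈-filter⁻ (λ p → at τ (proj₁ p) ℕ.≟ at τ (proj₂ p)) {xs = cartesianProduct (upTo n) (upTo n)} p∈
      ... | p∈′ , eq with ∈-cartesianProduct⁻ (upTo n) (upTo n) p∈′
      ... | i∈ , j∈ = ∈-upTo⁻ i∈ , ∈-upTo⁻ j∈ , ≤ᴾ⇒Refines τ r lτ lr (proj₂ e₁₂) (∈-upTo⁻ i∈) (∈-upTo⁻ j∈) eq
    from : ∀ r → length r ≡ n → t ≤ᴾ r ≡ true → (σ ≤ᴾ r) ∧ (τ ≤ᴾ r) ≡ true
    from r lr e = ∧-true⁺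
      (Refines⇒≤ᴾ σ r lσ lr λ i< j< e′ → ref i< j<
        (≡.trans (at-t i<) (≡.trans (≡.cong (relabel σ ps) e′) (≡.sym (at-t j<)))))
      (Refines⇒≤ᴾ τ r lτ lr λ i< j< e′ → ref i< j<
        (≡.trans (at-t i<) (≡.trans
          (relabel-merges σ ps (∈-filter⁺ _ (∈-cartesianProduct⁺ (∈-upTo⁺ i<) (∈-upTo⁺ j<)) e′)) (≡.sym (at-t j<)))))
      where
      ref : Refines t r
      ref = ≤ᴾ⇒Refines t r lt lr e

-- GrowthString n m s: s is an n-letter continuation of a string using the labels 0, …, m - 1.
data GrowthString : ℕ → ℕ → List ℕ → Set where
  []       : ∀ {m} → GrowthString 0 m []
  existing : ∀ {n m j s} → j < m → GrowthString n m s → GrowthString (suc n) m (j ∷ s)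
  fresh    : ∀ {n m s} → GrowthString n (suc m) s → GrowthString (suc n) m (m ∷ s)

∈-partsFrom : ∀ n m {s} → s ∈ partsFrom n m → GrowthString n m s
∈-partsFrom zero    m (here refl) = []
∈-partsFrom (suc n) m s∈ with find (∈-concatMap⁻
  (λ j → map (j ∷_) (partsFrom n (if j ≡ᵇ m then suc m else m))) {xs = upTo (suc m)} s∈)
... | j , j∈ , s∈′ with ∈-map⁻ (j ∷_) s∈′
... | s , s∈″ , refl with j ℕ.≟ m
... | yes refl rewrite ≡ᵇ-refl m = fresh (∈-partsFrom n (suc m) s∈″)
... | no j≢m rewrite ≢⇒≡ᵇ-false j≢m =
  existing (ℕₚ.≤∧≢⇒< (ℕₚ.≤-pred (∈-upTo⁻ j∈)) j≢m) (∈-partsFrom n m s∈″)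

growth-length : ∀ {n m s} → GrowthString n m s → length s ≡ n
growth-length []             = refl
growth-length (existing _ g) = ≡.cong suc (growth-length g)
growth-length (fresh g)      = ≡.cong suc (growth-length g)

labels<nBlocks : ∀ s → All (_< nBlocks s) s
labels<nBlocks []      = []
labels<nBlocks (x ∷ s) rewrite nBlocks-∷ x s =
  ℕₚ.m≤m⊔n (suc x) (nBlocks s) ∷ All.map (λ lt → ℕₚ.<-≤-trans lt (ℕₚ.m≤n⊔m (suc x) (nBlocks s))) (labels<nBlocks s)

-- Falling factorials and binomial coefficients

nPk*[n∸k]!≡n! : ∀ {n k} → k ≤ n → (n ↓ k) ℕ.* (n ∸ k) ! ≡ n !
nPk*[n∸k]!≡n! {n} {k} k≤n = ≡.trans (≡.cong (ℕ._* (n ∸ k) !) (nPk≡n!/[n∸k]! k≤n))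
  (m/n*n≡m {{(n ∸ k) ℕₚ.!≢0}} (m≤n⇒m!∣n! (ℕₚ.m∸n≤m n k)))

nCk*k!≡nPk : ∀ {n k} → k ≤ n → (n C k) ℕ.* k ! ≡ n ↓ k
nCk*k!≡nPk {n} {k} k≤n = ℕₚ.*-cancelʳ-≡ _ _ ((n ∸ k) !) {{(n ∸ k) ℕₚ.!≢0}} (begin
  (n C k) ℕ.* k ! ℕ.* (n ∸ k) !   ≡⟨ ℕₚ.*-assoc (n C k) (k !) _ ⟩
  (n C k) ℕ.* (k ! ℕ.* (n ∸ k) !) ≡⟨ ≡.cong (ℕ._* (k ! ℕ.* (n ∸ k) !)) (nCk≡n!/k![n-k]! k≤n) ⟩
  _                               ≡⟨ m/n*n≡m {{k ℕₚ.!* (n ∸ k) !≢0}}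
                                       (≡.subst (_∣ n !) (ℕₚ.*-comm ((n ∸ k) !) (k !)) ([n∸k]!k!∣n! k≤n)) ⟩
  n !                             ≡⟨ nPk*[n∸k]!≡n! k≤n ⟨
  (n ↓ k) ℕ.* (n ∸ k) !           ∎)
  where open ≡.≡-Reasoning

nPk≢0 : ∀ {n k} → k ≤ n → NonZero (n ↓ k)
nPk≢0 {n} {k} k≤n = ℕₚ.m*n≢0⇒m≢0 (n ↓ k) {{≡.subst NonZero (≡.sym (nPk*[n∸k]!≡n! k≤n)) (n ℕₚ.!≢0)}}

nCk≢0 : ∀ {n k} → k ≤ n → NonZero (n C k)
nCk≢0 {n} {k} k≤n = ℕₚ.m*n≢0⇒m≢0 (n C k) {{≡.subst NonZero (≡.sym (nCk*k!≡nPk k≤n)) (nPk≢0 k≤n)}}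

-- Block sizes of a growth string

sum-upTo-suc : ∀ f K → sum (map f (upTo (suc K))) ≡ sum (map f (upTo K)) ℕ.+ f K
sum-upTo-suc f K = begin
  sum (map f (upTo (suc K)))           ≡⟨ ≡.cong (sum ∘ map f) (Listₚ.upTo-∷ʳ K) ⟨
  sum (map f (upTo K ++ K ∷ []))       ≡⟨ ≡.cong sum (Listₚ.map-++ f (upTo K) (K ∷ [])) ⟩
  sum (map f (upTo K) ++ f K ∷ [])     ≡⟨ sum-++ (map f (upTo K)) (f K ∷ []) ⟩
  sum (map f (upTo K)) ℕ.+ (f K ℕ.+ 0) ≡⟨ ≡.cong (sum (map f (upTo K)) ℕ.+_) (ℕₚ.+-identityʳ (f K)) ⟩
  sum (map f (upTo K)) ℕ.+ f K         ∎
  where open ≡.≡-Reasoning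

sum-count-absent : ∀ {x} s K → K ≤ x →
  sum (map (λ j → count j (x ∷ s)) (upTo K)) ≡ sum (map (λ j → count j s) (upTo K))
sum-count-absent s zero    _ = refl
sum-count-absent {x} s (suc K) K<x
  rewrite sum-upTo-suc (λ j → count j (x ∷ s)) K | sum-upTo-suc (λ j → count j s) K
        | sum-count-absent s K (ℕₚ.<⇒≤ K<x) | ≢⇒≡ᵇ-false (ℕₚ.<⇒≢ K<x) = refl

sum-count-∷ : ∀ {x} s K → x < K →
  sum (map (λ j → count j (x ∷ s)) (upTo K)) ≡ suc (sum (map (λ j → count j s) (upTo K)))
sum-count-∷ {x} s (suc K) x<1+K
  rewrite sum-upTo-suc (λ j → count j (x ∷ s)) K | sum-upTo-suc (λ j → count j s) K with x ℕ.≟ K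
... | yes refl rewrite sum-count-absent s x (ℕₚ.≤-refl {x}) | ≡ᵇ-refl x = ℕₚ.+-suc _ (count x s)
... | no x≢K rewrite sum-count-∷ s K (ℕₚ.≤∧≢⇒< (ℕₚ.≤-pred x<1+K) x≢K) | ≢⇒≡ᵇ-false (x≢K ∘ ≡.sym) = refl

sum-zero : ∀ K → sum (map (λ _ → 0) (upTo K)) ≡ 0
sum-zero zero = refl
sum-zero (suc K) rewrite sum-upTo-suc (λ _ → 0) K | sum-zero K = refl

sum-count : ∀ {K} s → All (_< K) s → sum (map (λ j → count j s) (upTo K)) ≡ length s
sum-count {K} []      []         = sum-zero K
sum-count {K} (x ∷ s) (x< ∷ s<) = ≡.trans (sum-count-∷ s K x<) (≡.cong suc (sum-count s s<))

sum-blockSizes : ∀ s → sum (blockSizes s) ≡ length s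
sum-blockSizes s = sum-count s (labels<nBlocks s)

length-blockSizes : ∀ s → length (blockSizes s) ≡ nBlocks s
length-blockSizes s = ≡.trans (Listₚ.length-map _ (upTo (nBlocks s))) (Listₚ.length-upTo (nBlocks s))

count≤length : ∀ j s → count j s ≤ length s
count≤length j []      = z≤n
count≤length j (x ∷ s) with j ≡ᵇ x
... | true  = s≤s (count≤length j s)
... | false = ℕₚ.m≤n⇒m≤1+n (count≤length j s)

count-self : ∀ j s → 0 < count j (j ∷ s)
count-self j s rewrite ≡ᵇ-refl j = s≤s z≤n

count-mono : ∀ j x s → 0 < count j s → 0 < count j (x ∷ s)
count-mono j x s lt = ℕₚ.<-≤-trans lt (ℕₚ.m≤n+m (count j s) _)

-- Fresh labels are introduced in order and without gaps, so no block is empty. This makes the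
-- exponent n - |π| of the Möbius function a sum of the nonnegative contributions |V| - 1.
growth-count : ∀ {n m s} → GrowthString n m s → ∀ {j} → m ≤ j → j < m ⊔ nBlocks s → 0 < count j s
growth-count {m = m} [] {j} m≤j j< rewrite ℕₚ.⊔-identityʳ m = ⊥-elim (ℕₚ.<⇒≱ j< m≤j)
growth-count (existing {j = x} {s} x<m g) {j} m≤j j< rewrite ⊔-nBlocks-old s x<m =
  count-mono j x s (growth-count g m≤j j<)
growth-count (fresh {m = m} {s} g) {j} m≤j j< rewrite ⊔-nBlocks-new m s with j ℕ.≟ m
... | yes refl = count-self j s
... | no j≢m   = count-mono j m s (growth-count g (ℕₚ.≤∧≢⇒< m≤j (j≢m ∘ ≡.sym)) j<)

blockSizes-bounds : ∀ {n s} → GrowthString n 0 s → All (λ k → 0 < k × k ≤ n) (blockSizes s)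
blockSizes-bounds {n} {s} g = Allₚ.map⁺ (All.tabulate λ {j} j∈ →
  growth-count g z≤n (∈-upTo⁻ j∈) , ≡.subst (count j s ≤_) (growth-length g) (count≤length j s))

module FiniteFree {c ℓ : Level} (F : CharZeroField c ℓ) where
  open CharZeroField F hiding (refl; sym; trans; zero)
  module F = CharZeroField F
  open import Relation.Binary.Reasoning.Setoid setoid
  open import Algebra.Solver.Ring.NaturalCoefficients.Default commutativeSemiring
    using (solve; _:=_; _:+_; _:*_; con)
  open import Algebra.Properties.Ring ring

  -- Exponential generating functions

  Seq : Set c
  Seq = ℕ → Carrier

  infix 4 _≋_
  _≋_ : Seq → Seq → Set ℓ
  f ≋ g = ∀ n → f n ≈ g n

  infixl 7 _⋆_ _·_
  infixl 6 _⊕_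

  ∂ : Seq → Seq
  ∂ f n = f (suc n)

  _⊕_ : Seq → Seq → Seq
  (f ⊕ g) n = f n + g n

  _·_ : Carrier → Seq → Seq
  (a · f) n = a * f n

  𝟘 δ : Seq
  𝟘 _ = 0#
  δ zero    = 1#
  δ (suc _) = 0#

  -- Binomial convolution ∑ₖ C(n,k) fₖ gₙ₋ₖ, i.e. the product of exponential
  -- generating functions, given by the Leibniz rule.
  _⋆_ : Seq → Seq → Seq
  (f ⋆ g) zero    = f 0 * g 0
  (f ⋆ g) (suc n) = (∂ f ⋆ g) n + (f ⋆ ∂ g) n

  ⋆-cong-≤ : ∀ {f f′ g g′} n → (∀ k → k ≤ n → f k ≈ f′ k) → (∀ k → k ≤ n → g k ≈ g′ k) →
             (f ⋆ g) n ≈ (f′ ⋆ g′) n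
  ⋆-cong-≤ zero    p q = *-cong (p 0 z≤n) (q 0 z≤n)
  ⋆-cong-≤ (suc n) p q = +-cong
    (⋆-cong-≤ n (λ k le → p (suc k) (s≤s le)) (λ k le → q k (ℕₚ.m≤n⇒m≤1+n le)))
    (⋆-cong-≤ n (λ k le → p k (ℕₚ.m≤n⇒m≤1+n le)) (λ k le → q (suc k) (s≤s le)))

  ⋆-cong : ∀ {f f′ g g′} → f ≋ f′ → g ≋ g′ → f ⋆ g ≋ f′ ⋆ g′
  ⋆-cong p q n = ⋆-cong-≤ n (λ k _ → p k) (λ k _ → q k)

  ⋆-congˡ : ∀ {f g g′} → g ≋ g′ → f ⋆ g ≋ f ⋆ g′
  ⋆-congˡ = ⋆-cong (λ _ → F.refl)

  ⋆-congʳ : ∀ {f f′ g} → f ≋ f′ → f ⋆ g ≋ f′ ⋆ g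
  ⋆-congʳ p = ⋆-cong p (λ _ → F.refl)

  ⋆-comm : ∀ f g → f ⋆ g ≋ g ⋆ f
  ⋆-comm f g zero    = *-comm _ _
  ⋆-comm f g (suc n) = F.trans (+-cong (⋆-comm (∂ f) g n) (⋆-comm f (∂ g) n)) (+-comm _ _)

  ⋆-distribʳ : ∀ f g h → (f ⊕ g) ⋆ h ≋ f ⋆ h ⊕ g ⋆ h
  ⋆-distribʳ f g h zero    = distribʳ _ _ _
  ⋆-distribʳ f g h (suc n) = F.trans
    (+-cong (⋆-distribʳ (∂ f) (∂ g) h n) (⋆-distribʳ f g (∂ h) n))
    (solve 4 (λ a b x y → (a :+ b) :+ (x :+ y) := (a :+ x) :+ (b :+ y)) F.refl _ _ _ _)

  ⋆-distribˡ : ∀ f g h → f ⋆ (g ⊕ h) ≋ f ⋆ g ⊕ f ⋆ h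
  ⋆-distribˡ f g h n = begin
    (f ⋆ (g ⊕ h)) n          ≈⟨ ⋆-comm f (g ⊕ h) n ⟩
    ((g ⊕ h) ⋆ f) n          ≈⟨ ⋆-distribʳ g h f n ⟩
    (g ⋆ f) n + (h ⋆ f) n    ≈⟨ +-cong (⋆-comm g f n) (⋆-comm h f n) ⟩
    (f ⋆ g) n + (f ⋆ h) n    ∎

  ⋆-assoc : ∀ f g h → (f ⋆ g) ⋆ h ≋ f ⋆ (g ⋆ h)
  ⋆-assoc f g h zero    = *-assoc _ _ _
  ⋆-assoc f g h (suc n) = begin
    ((∂ f ⋆ g ⊕ f ⋆ ∂ g) ⋆ h) n + ((f ⋆ g) ⋆ ∂ h) n
      ≈⟨ +-congʳ (⋆-distribʳ (∂ f ⋆ g) (f ⋆ ∂ g) h n) ⟩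
    (((∂ f ⋆ g) ⋆ h) n + ((f ⋆ ∂ g) ⋆ h) n) + ((f ⋆ g) ⋆ ∂ h) n
      ≈⟨ +-cong (+-cong (⋆-assoc (∂ f) g h n) (⋆-assoc f (∂ g) h n)) (⋆-assoc f g (∂ h) n) ⟩
    ((∂ f ⋆ (g ⋆ h)) n + (f ⋆ (∂ g ⋆ h)) n) + (f ⋆ (g ⋆ ∂ h)) n
      ≈⟨ +-assoc _ _ _ ⟩
    (∂ f ⋆ (g ⋆ h)) n + ((f ⋆ (∂ g ⋆ h)) n + (f ⋆ (g ⋆ ∂ h)) n)
      ≈⟨ +-congˡ (⋆-distribˡ f (∂ g ⋆ h) (g ⋆ ∂ h) n) ⟨
    (∂ f ⋆ (g ⋆ h)) n + (f ⋆ (∂ g ⋆ h ⊕ g ⋆ ∂ h)) n ∎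

  ⋆-·ˡ : ∀ a f g → (a · f) ⋆ g ≋ a · (f ⋆ g)
  ⋆-·ˡ a f g zero    = *-assoc _ _ _
  ⋆-·ˡ a f g (suc n) = F.trans (+-cong (⋆-·ˡ a (∂ f) g n) (⋆-·ˡ a f (∂ g) n)) (F.sym (distribˡ _ _ _))

  ⋆-·ʳ : ∀ a f g → f ⋆ (a · g) ≋ a · (f ⋆ g)
  ⋆-·ʳ a f g n = F.trans (⋆-comm f (a · g) n) (F.trans (⋆-·ˡ a g f n) (*-congˡ (⋆-comm g f n)))

  ⋆-zeroˡ : ∀ g → 𝟘 ⋆ g ≋ 𝟘
  ⋆-zeroˡ g zero    = zeroˡ _
  ⋆-zeroˡ g (suc n) = F.trans (+-cong (⋆-zeroˡ g n) (⋆-zeroˡ (∂ g) n)) (+-identityˡ _)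

  ⋆-zeroʳ : ∀ f → f ⋆ 𝟘 ≋ 𝟘
  ⋆-zeroʳ f n = F.trans (⋆-comm f 𝟘 n) (⋆-zeroˡ f n)

  ⋆-identityˡ : ∀ g → δ ⋆ g ≋ g
  ⋆-identityˡ g zero    = *-identityˡ _
  ⋆-identityˡ g (suc n) = F.trans (+-cong (⋆-zeroˡ g n) (⋆-identityˡ (∂ g) n)) (+-identityˡ _)

  ⋆-identityʳ : ∀ f → f ⋆ δ ≋ f
  ⋆-identityʳ f n = F.trans (⋆-comm f δ n) (⋆-identityˡ f n)

  ⋆-swap : ∀ f g h → f ⋆ (g ⋆ h) ≋ g ⋆ (f ⋆ h)
  ⋆-swap f g h n = begin
    (f ⋆ (g ⋆ h)) n ≈⟨ ⋆-assoc f g h n ⟨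
    ((f ⋆ g) ⋆ h) n ≈⟨ ⋆-congʳ (⋆-comm f g) n ⟩
    ((g ⋆ f) ⋆ h) n ≈⟨ ⋆-assoc g f h n ⟩
    (g ⋆ (f ⋆ h)) n ∎

  -- The value of `b ⋆ y` at k involves `y` only up to k, so the equation determines y at k + 1 from
  -- earlier values. This stands in for manipulating exponentials.
  linear-ode-unique : ∀ {b y z} → y 0 ≈ z 0 → ∂ y ≋ b ⋆ y → ∂ z ≋ b ⋆ z → y ≋ z
  linear-ode-unique {b} {y} {z} y₀ y′ z′ n = go n n ℕₚ.≤-refl
    where
    go : ∀ n k → k ≤ n → y k ≈ z k
    go n       zero    _        = y₀
    go (suc n) (suc k) (s≤s le) = begin
      y (suc k)  ≈⟨ y′ k ⟩
      (b ⋆ y) k  ≈⟨ ⋆-cong-≤ k (λ _ _ → F.refl) (λ i i≤k → go n i (ℕₚ.≤-trans i≤k le)) ⟩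
      (b ⋆ z) k  ≈⟨ z′ k ⟨
      z (suc k)  ∎

  -- Unfolded at the last index, so that opening block `m` appends one factor definitionally.
  ∑< ∏< : ℕ → Seq → Carrier
  ∑< zero    f = 0#
  ∑< (suc m) f = ∑< m f + f m
  ∏< zero    f = 1#
  ∏< (suc m) f = ∏< m f * f m

  ⨂< : ℕ → (ℕ → Seq) → Seq
  ⨂< zero    f = δ
  ⨂< (suc m) f = ⨂< m f ⋆ f m

  ∑<-cong : ∀ m {f g} → (∀ j → j ℕ.< m → f j ≈ g j) → ∑< m f ≈ ∑< m g
  ∑<-cong zero    p = F.refl
  ∑<-cong (suc m) p = +-cong (∑<-cong m (λ j lt → p j (ℕₚ.m≤n⇒m≤1+n lt))) (p m ℕₚ.≤-refl)

  ∏<-cong : ∀ m {f g} → (∀ j → j ℕ.< m → f j ≈ g j) → ∏< m f ≈ ∏< m g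
  ∏<-cong zero    p = F.refl
  ∏<-cong (suc m) p = *-cong (∏<-cong m (λ j lt → p j (ℕₚ.m≤n⇒m≤1+n lt))) (p m ℕₚ.≤-refl)

  ⨂<-cong : ∀ m {f g} → (∀ j → j ℕ.< m → f j ≋ g j) → ⨂< m f ≋ ⨂< m g
  ⨂<-cong zero    p n = F.refl
  ⨂<-cong (suc m) p n = ⋆-cong (⨂<-cong m (λ j lt → p j (ℕₚ.m≤n⇒m≤1+n lt))) (p m ℕₚ.≤-refl) n

  ⨂<-zero : ∀ m f → ⨂< m f 0 ≈ ∏< m (λ j → f j 0)
  ⨂<-zero zero    f = F.refl
  ⨂<-zero (suc m) f = *-congʳ (⨂<-zero m f)

  ∑<-*ʳ : ∀ m f a → ∑< m f * a ≈ ∑< m (λ j → f j * a)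
  ∑<-*ʳ zero    f a = zeroˡ a
  ∑<-*ʳ (suc m) f a = F.trans (distribʳ _ _ _) (+-congʳ (∑<-*ʳ m f a))

  ∑<-*ˡ : ∀ m f a → a * ∑< m f ≈ ∑< m (λ j → a * f j)
  ∑<-*ˡ zero    f a = zeroʳ a
  ∑<-*ˡ (suc m) f a = F.trans (distribˡ _ _ _) (+-congʳ (∑<-*ˡ m f a))

  ∑<-zero : ∀ m {f} → (∀ j → j ℕ.< m → f j ≈ 0#) → ∑< m f ≈ 0#
  ∑<-zero zero    p = F.refl
  ∑<-zero (suc m) p = F.trans (+-cong (∑<-zero m (λ j lt → p j (ℕₚ.m≤n⇒m≤1+n lt))) (p m ℕₚ.≤-refl)) (+-identityˡ _)

  ∏<-* : ∀ m f g → ∏< m f * ∏< m g ≈ ∏< m (λ j → f j * g j)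
  ∏<-* zero    f g = *-identityˡ _
  ∏<-* (suc m) f g = F.trans
    (solve 4 (λ a b x y → (a :* b) :* (x :* y) := (a :* x) :* (b :* y)) F.refl _ _ _ _)
    (*-congʳ (∏<-* m f g))

  ⋆-∑<ˡ : ∀ m (f : ℕ → Seq) g n → ((λ k → ∑< m (λ j → f j k)) ⋆ g) n ≈ ∑< m (λ j → (f j ⋆ g) n)
  ⋆-∑<ˡ zero    f g n = ⋆-zeroˡ g n
  ⋆-∑<ˡ (suc m) f g n = F.trans (⋆-distribʳ _ (f m) g n) (+-congʳ (⋆-∑<ˡ m f g n))

  -- Sums over partitions

  private variable
    ℓ₁ ℓ₂ : Level
    Ix : Set ℓ₁
    Iy : Set ℓ₂

  ∑ : List Ix → (Ix → Carrier) → Carrier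
  ∑ xs f = Σ F (map f xs)

  ∑-cong : ∀ (xs : List Ix) {f g : Ix → Carrier} → (∀ x → x ∈ xs → f x ≈ g x) → ∑ xs f ≈ ∑ xs g
  ∑-cong []       p = F.refl
  ∑-cong (x ∷ xs) p = +-cong (p x (here refl)) (∑-cong xs (λ y y∈ → p y (there y∈)))

  ∑-++ : ∀ (xs ys : List Ix) f → ∑ (xs ++ ys) f ≈ ∑ xs f + ∑ ys f
  ∑-++ []       ys f = F.sym (+-identityˡ _)
  ∑-++ (x ∷ xs) ys f = F.trans (+-congˡ (∑-++ xs ys f)) (F.sym (+-assoc _ _ _))

  ∑-map : ∀ (h : Ix → Iy) xs f → ∑ (map h xs) f ≡ ∑ xs (f ∘ h)
  ∑-map h xs f = ≡.cong (Σ F) (≡.sym (Listₚ.map-∘ xs))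

  ∑-concatMap : ∀ (h : Ix → List Iy) xs f → ∑ (concatMap h xs) f ≈ ∑ xs (λ x → ∑ (h x) f)
  ∑-concatMap h []       f = F.refl
  ∑-concatMap h (x ∷ xs) f = F.trans (∑-++ (h x) _ f) (+-congˡ (∑-concatMap h xs f))

  ∑-upTo : ∀ m f → ∑ (upTo m) f ≈ ∑< m f
  ∑-upTo zero    f = F.refl
  ∑-upTo (suc m) f = begin
    ∑ (upTo (suc m)) f      ≡⟨ ≡.cong (λ xs → ∑ xs f) (Listₚ.upTo-∷ʳ m) ⟨
    ∑ (upTo m ++ m ∷ []) f  ≈⟨ ∑-++ (upTo m) (m ∷ []) f ⟩
    ∑ (upTo m) f + (f m + 0#) ≈⟨ +-cong (∑-upTo m f) (+-identityʳ _) ⟩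
    ∑< m f + f m            ∎

  Π-++ : ∀ xs ys → Π F (xs ++ ys) ≈ Π F xs * Π F ys
  Π-++ []       ys = F.sym (*-identityˡ _)
  Π-++ (x ∷ xs) ys = F.trans (*-congˡ (Π-++ xs ys)) (F.sym (*-assoc _ _ _))

  Π-upTo : ∀ m f → Π F (map f (upTo m)) ≈ ∏< m f
  Π-upTo zero    f = F.refl
  Π-upTo (suc m) f = begin
    Π F (map f (upTo (suc m)))            ≡⟨ ≡.cong (Π F ∘ map f) (Listₚ.upTo-∷ʳ m) ⟨
    Π F (map f (upTo m ++ m ∷ []))        ≡⟨ ≡.cong (Π F) (Listₚ.map-++ f (upTo m) (m ∷ [])) ⟩
    Π F (map f (upTo m) ++ f m ∷ [])      ≈⟨ Π-++ (map f (upTo m)) _ ⟩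
    Π F (map f (upTo m)) * (f m * 1#)     ≈⟨ *-cong (Π-upTo m f) (*-identityʳ _) ⟩
    ∏< m f * f m                          ∎

  ∑-zero : ∀ (xs : List Ix) → ∑ xs (λ _ → 0#) ≈ 0#
  ∑-zero []       = F.refl
  ∑-zero (x ∷ xs) = F.trans (+-identityˡ _) (∑-zero xs)

  ∑-+ : ∀ (xs : List Ix) f g → ∑ xs (λ x → f x + g x) ≈ ∑ xs f + ∑ xs g
  ∑-+ []       f g = F.sym (+-identityˡ _)
  ∑-+ (x ∷ xs) f g = F.trans (+-congˡ (∑-+ xs f g))
    (solve 4 (λ a b x y → (a :+ b) :+ (x :+ y) := (a :+ x) :+ (b :+ y)) F.refl _ _ _ _)

  ∑-*ˡ : ∀ (xs : List Ix) a f → a * ∑ xs f ≈ ∑ xs (λ x → a * f x)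
  ∑-*ˡ []       a f = zeroʳ a
  ∑-*ˡ (x ∷ xs) a f = F.trans (distribˡ _ _ _) (+-congˡ (∑-*ˡ xs a f))

  ∑-*ʳ : ∀ (xs : List Ix) a f → ∑ xs f * a ≈ ∑ xs (λ x → f x * a)
  ∑-*ʳ []       a f = zeroˡ a
  ∑-*ʳ (x ∷ xs) a f = F.trans (distribʳ _ _ _) (+-congˡ (∑-*ʳ xs a f))

  ∑-swap : ∀ (xs : List Ix) (ys : List Iy) (f : Ix → Iy → Carrier) →
    ∑ xs (λ x → ∑ ys (f x)) ≈ ∑ ys (λ y → ∑ xs (λ x → f x y))
  ∑-swap []       ys f = F.sym (∑-zero ys)
  ∑-swap (x ∷ xs) ys f = F.trans (+-congˡ (∑-swap xs ys f)) (F.sym (∑-+ ys (f x) _))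

  -- The next element either joins one of the `m` open blocks or opens block `m`. All partition sums
  -- below are computed from this recursion.
  ∑-partsFrom-suc : ∀ n m f → ∑ (partsFrom (suc n) m) f ≈
    ∑< m (λ j → ∑ (partsFrom n m) (f ∘ (j ∷_))) + ∑ (partsFrom n (suc m)) (f ∘ (m ∷_))
  ∑-partsFrom-suc n m f = begin
    ∑ (partsFrom (suc n) m) f
      ≈⟨ ∑-concatMap (λ j → map (j ∷_) (ext j)) (upTo (suc m)) f ⟩
    ∑ (upTo (suc m)) (λ j → ∑ (map (j ∷_) (ext j)) f)
      ≈⟨ ∑-upTo (suc m) _ ⟩
    ∑< m (λ j → ∑ (map (j ∷_) (ext j)) f) + ∑ (map (m ∷_) (ext m)) f
      ≈⟨ +-cong (∑<-cong m old) new ⟩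
    ∑< m (λ j → ∑ (partsFrom n m) (f ∘ (j ∷_))) + ∑ (partsFrom n (suc m)) (f ∘ (m ∷_)) ∎
    where
    ext : ℕ → List (List ℕ)
    ext j = partsFrom n (if j ≡ᵇ m then suc m else m)
    old : ∀ j → j ℕ.< m → ∑ (map (j ∷_) (ext j)) f ≈ ∑ (partsFrom n m) (f ∘ (j ∷_))
    old j j<m rewrite ≢⇒≡ᵇ-false (ℕₚ.<⇒≢ j<m) = F.reflexive (∑-map (j ∷_) (partsFrom n m) f)
    new : ∑ (map (m ∷_) (ext m)) f ≈ ∑ (partsFrom n (suc m)) (f ∘ (m ∷_))
    new rewrite ≡ᵇ-refl m = F.reflexive (∑-map (m ∷_) (partsFrom n (suc m)) f)

  -- Written so that f applied to the counts of x ∷ s is definitionally bump x f applied to those of s.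
  bump : ℕ → (ℕ → Seq) → (ℕ → Seq)
  bump x f i k = f i ((if i ≡ᵇ x then 1 else 0) ℕ.+ k)

  bump-≡ : ∀ x f → bump x f x ≋ ∂ (f x)
  bump-≡ x f k rewrite ≡ᵇ-refl x = F.refl

  bump-≢ : ∀ {x i} f → i ≢ x → bump x f i ≋ f i
  bump-≢ f i≢x k rewrite ≢⇒≡ᵇ-false i≢x = F.refl

  -- Combinatorially, the next element joins some block j and differentiates the factor of that
  -- block alone; this is the first sum of `∑-partsFrom-suc`.
  ⨂<-leibniz : ∀ m f → ∂ (⨂< m f) ≋ (λ n → ∑< m (λ j → ⨂< m (bump j f) n))
  ⨂<-leibniz zero    f n = F.refl
  ⨂<-leibniz (suc m) f n = +-cong
    (begin
      (∂ (⨂< m f) ⋆ f m) n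
        ≈⟨ ⋆-congʳ (⨂<-leibniz m f) n ⟩
      ((λ k → ∑< m (λ j → ⨂< m (bump j f) k)) ⋆ f m) n
        ≈⟨ ⋆-∑<ˡ m (λ j → ⨂< m (bump j f)) (f m) n ⟩
      ∑< m (λ j → (⨂< m (bump j f) ⋆ f m) n)
        ≈⟨ ∑<-cong m (λ j j<m → ⋆-congˡ (λ k → F.sym (bump-≢ f (ℕₚ.>⇒≢ j<m) k)) n) ⟩
      ∑< m (λ j → (⨂< m (bump j f) ⋆ bump j f m) n) ∎)
    (⋆-cong (⨂<-cong m (λ j j<m k → F.sym (bump-≢ f (ℕₚ.<⇒≢ j<m) k))) (λ k → F.sym (bump-≡ m f k)) n)

  blockProduct : (ℕ → Seq) → ℕ → List ℕ → Carrier
  blockProduct f m s = ∏< (m ⊔ nBlocks s) (λ j → f j (count j s))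

  -- With m blocks already open, block j contributes f j as a function of the number
  -- of its further elements; w weights the final number of blocks.
  term : Seq → (ℕ → Seq) → ℕ → List ℕ → Carrier
  term w f m s = w (m ⊔ nBlocks s) * blockProduct f m s

  blockProduct-old : ∀ f {m x} s → x ℕ.< m → blockProduct f m (x ∷ s) ≡ blockProduct (bump x f) m s
  blockProduct-old f {m} {x} s x<m rewrite ⊔-nBlocks-old s x<m = refl

  blockProduct-new : ∀ f m s → blockProduct f m (m ∷ s) ≡ blockProduct (bump m f) (suc m) s
  blockProduct-new f m s rewrite ⊔-nBlocks-new m s = refl

  term-old : ∀ w f {m x} s → x ℕ.< m → term w f m (x ∷ s) ≡ term w (bump x f) m s
  term-old w f {m} {x} s x<m rewrite ⊔-nBlocks-old s x<m = refl

  term-new : ∀ w f m s → term w f m (m ∷ s) ≡ term w (bump m f) (suc m) s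
  term-new w f m s rewrite ⊔-nBlocks-new m s = refl

  -- By the exponential formula this is the composite W(C(t)) of the generating functions of `w` and
  -- `c`, where C is taken without its constant term.
  partitionSum : Seq → Seq → Seq
  partitionSum w c n = ∑ (P n) (term w (λ _ → c) 0)

  shift : ℕ → Seq → Seq
  shift m w r = w (m ℕ.+ r)

  partitionSum-cong-w : ∀ {w w′} c → w ≋ w′ → partitionSum w c ≋ partitionSum w′ c
  partitionSum-cong-w c p n = ∑-cong (P n) (λ s _ → *-congʳ (p (nBlocks s)))

  partitionSum-zero : ∀ w c → partitionSum w c 0 ≈ w 0
  partitionSum-zero w c = F.trans (+-identityʳ _) (*-identityʳ _)

  -- Blocks still to be opened all contribute the same `c`, whereas open ones may carry anything, as
  -- they do after some `bump`s.
  Default : ℕ → Seq → (ℕ → Seq) → Set ℓ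
  Default m c f = ∀ j → m ≤ j → f j ≋ c

  Default-bump-old : ∀ {m x c f} → x ℕ.< m → Default m c f → Default m c (bump x f)
  Default-bump-old {f = f} x<m df j m≤j k =
    F.trans (bump-≢ f (ℕₚ.>⇒≢ (ℕₚ.<-≤-trans x<m m≤j)) k) (df j m≤j k)

  Default-bump-new : ∀ {m c f} → Default m c f → Default (suc m) c (bump m f)
  Default-bump-new {f = f} df j m<j k = F.trans (bump-≢ f (ℕₚ.>⇒≢ m<j) k) (df j (ℕₚ.<⇒≤ m<j) k)

  ⨂<-bump-new : ∀ {m c f} → Default m c f → ⨂< (suc m) (bump m f) ≋ ⨂< m f ⋆ ∂ c
  ⨂<-bump-new {m} {c} {f} df = ⋆-cong (⨂<-cong m (λ j j<m → bump-≢ f (ℕₚ.<⇒≢ j<m)))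
                       (λ k → F.trans (bump-≡ m f k) (df m ℕₚ.≤-refl (suc k)))

  -- The remaining elements are shared out between the open blocks and a partition into new blocks,
  -- whose number reaches `w` increased by `m`. Both sides obey the recursion that removes the first
  -- remaining element: joining an open block differentiates the left factor, opening a block the
  -- right one.
  ∑-term : ∀ n w m c f → Default m c f → 
           ∑ (partsFrom n m) (term w f m) ≈ (⨂< m f ⋆ partitionSum (shift m w) c) n
  ∑-term n w m c f df = go n n ℕₚ.≤-refl w m f df
    where
    go : ∀ N n → n ≤ N → ∀ w m f → Default m c f →
         ∑ (partsFrom n m) (term w f m) ≈ (⨂< m f ⋆ partitionSum (shift m w) c) n
    go N zero _ w m f df = begin
      w (m ⊔ 0) * ∏< (m ⊔ 0) (λ j → f j 0) + 0#
        ≈⟨ +-identityʳ _ ⟩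
      w (m ⊔ 0) * ∏< (m ⊔ 0) (λ j → f j 0)
        ≡⟨ ≡.cong (λ k → w k * ∏< k (λ j → f j 0)) (ℕₚ.⊔-identityʳ m) ⟩
      w m * ∏< m (λ j → f j 0)
        ≈⟨ *-cong (F.reflexive (≡.cong w (≡.sym (ℕₚ.+-identityʳ m)))) (F.sym (⨂<-zero m f)) ⟩
      w (m ℕ.+ 0) * ⨂< m f 0
        ≈⟨ *-comm _ _ ⟩
      ⨂< m f 0 * w (m ℕ.+ 0)
        ≈⟨ *-congˡ (partitionSum-zero (shift m w) c) ⟨
      ⨂< m f 0 * partitionSum (shift m w) c 0 ∎
    go (suc N) (suc n) (s≤s n≤N) w m f df = begin
      ∑ (partsFrom (suc n) m) (term w f m)
        ≈⟨ ∑-partsFrom-suc n m (term w f m) ⟩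
      ∑< m (λ j → ∑ (partsFrom n m) (term w f m ∘ (j ∷_))) + ∑ (partsFrom n (suc m)) (term w f m ∘ (m ∷_))
        ≈⟨ +-cong (∑<-cong m old) new ⟩
      ∑< m (λ j → (⨂< m (bump j f) ⋆ E m) n) + (⨂< (suc m) (bump m f) ⋆ E (suc m)) n
        ≈⟨ +-cong left right ⟩
      (∂ (⨂< m f) ⋆ E m) n + (⨂< m f ⋆ ∂ (E m)) n ∎
      where
      E : ℕ → Seq
      E m = partitionSum (shift m w) c
      old : ∀ j → j ℕ.< m → ∑ (partsFrom n m) (term w f m ∘ (j ∷_)) ≈ (⨂< m (bump j f) ⋆ E m) n
      old j j<m = F.trans
        (∑-cong (partsFrom n m) (λ s _ → F.reflexive (term-old w f s j<m)))
        (go N n n≤N w m (bump j f) (Default-bump-old j<m df))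
      new : ∑ (partsFrom n (suc m)) (term w f m ∘ (m ∷_)) ≈ (⨂< (suc m) (bump m f) ⋆ E (suc m)) n
      new = F.trans
        (∑-cong (partsFrom n (suc m)) (λ s _ → F.reflexive (term-new w f m s)))
        (go N n n≤N w (suc m) (bump m f) (Default-bump-new df))
      left : ∑< m (λ j → (⨂< m (bump j f) ⋆ E m) n) ≈ (∂ (⨂< m f) ⋆ E m) n
      left = F.sym (F.trans (⋆-congʳ (⨂<-leibniz m f) n) (⋆-∑<ˡ m (λ j → ⨂< m (bump j f)) (E m) n))
      -- This is `∂-partitionSum` for a shifted weight, itself a consequence of the lemma. It comes
      -- from the induction hypothesis with a single open block, at every length k ≤ n, hence the
      -- bound `N`.
      E′ : ∀ k → k ≤ n → ∂ (E m) k ≈ (∂ c ⋆ E (suc m)) k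
      E′ k k≤n = begin
        E m (suc k)
          ≈⟨ ∑-partsFrom-suc k 0 (term (shift m w) (λ _ → c) 0) ⟩
        0# + ∑ (partsFrom k 1) (term (shift m w) (λ _ → c) 0 ∘ (0 ∷_))
          ≈⟨ +-identityˡ _ ⟩
        ∑ (partsFrom k 1) (term (shift m w) (λ _ → c) 0 ∘ (0 ∷_))
          ≈⟨ ∑-cong (partsFrom k 1) (λ s _ → F.reflexive (term-new (shift m w) (λ _ → c) 0 s)) ⟩
        ∑ (partsFrom k 1) (term (shift m w) (bump 0 (λ _ → c)) 1)
          ≈⟨ go N k (ℕₚ.≤-trans k≤n n≤N) (shift m w) 1 (bump 0 (λ _ → c)) (Default-bump-new {0} {c} (λ _ _ _ → F.refl)) ⟩
        ((δ ⋆ ∂ c) ⋆ partitionSum (shift 1 (shift m w)) c) k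
          ≈⟨ ⋆-cong (⋆-identityˡ (∂ c)) (partitionSum-cong-w c
               (λ r → F.reflexive (≡.cong w (ℕₚ.+-suc m r)))) k ⟩
        (∂ c ⋆ E (suc m)) k ∎
      right : (⨂< (suc m) (bump m f) ⋆ E (suc m)) n ≈ (⨂< m f ⋆ ∂ (E m)) n
      right = begin
        (⨂< (suc m) (bump m f) ⋆ E (suc m)) n    ≈⟨ ⋆-congʳ (⨂<-bump-new df) n ⟩
        ((⨂< m f ⋆ ∂ c) ⋆ E (suc m)) n           ≈⟨ ⋆-assoc (⨂< m f) (∂ c) (E (suc m)) n ⟩
        (⨂< m f ⋆ (∂ c ⋆ E (suc m))) n           ≈⟨ ⋆-cong-≤ n (λ _ _ → F.refl) (λ k k≤n → F.sym (E′ k k≤n)) ⟩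
        (⨂< m f ⋆ ∂ (E m)) n                     ∎

  -- The chain rule for W(C(t)): the block of the first element is split off and gives C′, and the
  -- others are counted by `∂ w`, that is, by W′.
  ∂-partitionSum : ∀ w c → ∂ (partitionSum w c) ≋ ∂ c ⋆ partitionSum (∂ w) c
  ∂-partitionSum w c n = begin
    partitionSum w c (suc n)
      ≈⟨ ∑-partsFrom-suc n 0 (term w (λ _ → c) 0) ⟩
    0# + ∑ (partsFrom n 1) (term w (λ _ → c) 0 ∘ (0 ∷_))
      ≈⟨ +-identityˡ _ ⟩
    ∑ (partsFrom n 1) (term w (λ _ → c) 0 ∘ (0 ∷_))
      ≈⟨ ∑-cong (partsFrom n 1) (λ s _ → F.reflexive (term-new w (λ _ → c) 0 s)) ⟩
    ∑ (partsFrom n 1) (term w (bump 0 (λ _ → c)) 1)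
      ≈⟨ ∑-term n w 1 c (bump 0 (λ _ → c)) (Default-bump-new {0} {c} (λ _ _ _ → F.refl)) ⟩
    ((δ ⋆ ∂ c) ⋆ partitionSum (∂ w) c) n
      ≈⟨ ⋆-congʳ (⋆-identityˡ (∂ c)) n ⟩
    (∂ c ⋆ partitionSum (∂ w) c) n ∎

  -- Reciprocals, logarithms and exponentials of generating functions

  ι-+ : ∀ m n → ι (m ℕ.+ n) ≈ ι m + ι n
  ι-+ zero    n = F.sym (+-identityˡ _)
  ι-+ (suc m) n = F.trans (+-congˡ (ι-+ m n)) (F.sym (+-assoc _ _ _))

  ι-* : ∀ m n → ι (m ℕ.* n) ≈ ι m * ι n
  ι-* zero    n = F.sym (zeroˡ _)
  ι-* (suc m) n = begin
    ι (n ℕ.+ m ℕ.* n)       ≈⟨ ι-+ n (m ℕ.* n) ⟩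
    ι n + ι (m ℕ.* n)       ≈⟨ +-congˡ (ι-* m n) ⟩
    ι n + ι m * ι n         ≈⟨ solve 2 (λ x y → x :+ y :* x := (con 1 :+ y) :* x) F.refl _ _ ⟩
    (1# + ι m) * ι n        ∎

  sgn : ℕ → Carrier
  sgn r = _^_ F (- 1#) r

  -- The derivatives at 0 of s! (1 + t)^(-(s+1)). The reciprocal itself is s = 0; the whole family
  -- is needed because differentiation raises the exponent.
  reciprocalWeight : ℕ → Seq
  reciprocalWeight s r = sgn r * ι ((s ℕ.+ r) !)

  ∂-reciprocalWeight : ∀ s → ∂ (reciprocalWeight s) ≋ (- 1#) · reciprocalWeight (suc s)
  ∂-reciprocalWeight s r = F.trans (*-congˡ (F.reflexive (≡.cong (λ k → ι (k !)) (ℕₚ.+-suc s r)))) (*-assoc _ _ _)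

  partitionSum-· : ∀ a w c → partitionSum (a · w) c ≋ a · partitionSum w c
  partitionSum-· a w c n = F.trans (∑-cong (P n) (λ _ _ → *-assoc _ _ _)) (F.sym (∑-*ˡ (P n) a _))

  ∂-partitionSum-reciprocal : ∀ s α →
    ∂ (partitionSum (reciprocalWeight s) α) ≋ (- 1#) · (∂ α ⋆ partitionSum (reciprocalWeight (suc s)) α)
  ∂-partitionSum-reciprocal s α n = begin
    partitionSum (reciprocalWeight s) α (suc n)
      ≈⟨ ∂-partitionSum (reciprocalWeight s) α n ⟩
    (∂ α ⋆ partitionSum (∂ (reciprocalWeight s)) α) n
      ≈⟨ ⋆-congˡ (λ k → F.trans (partitionSum-cong-w α (∂-reciprocalWeight s) k)
                     (partitionSum-· (- 1#) (reciprocalWeight (suc s)) α k)) n ⟩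
    (∂ α ⋆ ((- 1#) · partitionSum (reciprocalWeight (suc s)) α)) n
      ≈⟨ ⋆-·ʳ (- 1#) (∂ α) _ n ⟩
    (- 1#) * (∂ α ⋆ partitionSum (reciprocalWeight (suc s)) α) n ∎

  -- Writing A for the exponential generating function of α, partitionSum (reciprocalWeight s) α has
  -- generating function s! A^(-(s+1)).
  ⋆-partitionSum-reciprocal : ∀ α → α 0 ≈ 1# → ∀ s → 
    α ⋆ partitionSum (reciprocalWeight (suc s)) α ≋ ι (suc s) · partitionSum (reciprocalWeight s) α
  ⋆-partitionSum-reciprocal α α₀ s n = go n n ℕₚ.≤-refl s
    where
    A : ℕ → Seq
    A s = partitionSum (reciprocalWeight s) α
    go : ∀ N n → n ≤ N → ∀ s → (α ⋆ A (suc s)) n ≈ ι (suc s) * A s n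
    go N zero _ s = begin
      α 0 * A (suc s) 0
        ≈⟨ *-cong α₀ (partitionSum-zero (reciprocalWeight (suc s)) α) ⟩
      1# * (1# * ι (suc (s ℕ.+ 0) !))
        ≈⟨ *-congˡ (*-congˡ (F.trans (ι-* (suc (s ℕ.+ 0)) ((s ℕ.+ 0) !))
             (*-congʳ (F.reflexive (≡.cong (λ k → ι (suc k)) (ℕₚ.+-identityʳ s)))))) ⟩
      1# * (1# * (ι (suc s) * ι ((s ℕ.+ 0) !)))
        ≈⟨ solve 2 (λ x y → con 1 :* (con 1 :* (x :* y)) := x :* (con 1 :* y)) F.refl (ι (suc s)) (ι ((s ℕ.+ 0) !)) ⟩
      ι (suc s) * (1# * ι ((s ℕ.+ 0) !))
        ≈⟨ *-congˡ (partitionSum-zero (reciprocalWeight s) α) ⟨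
      ι (suc s) * A s 0 ∎
    go (suc N) (suc n) (s≤s n≤N) s = begin
      X + (α ⋆ ∂ (A (suc s))) n
        ≈⟨ +-congˡ (⋆-congˡ (∂-partitionSum-reciprocal (suc s) α) n) ⟩
      X + (α ⋆ ((- 1#) · (∂ α ⋆ A (suc (suc s))))) n
        ≈⟨ +-congˡ (⋆-·ʳ (- 1#) α _ n) ⟩
      X + (- 1#) * (α ⋆ (∂ α ⋆ A (suc (suc s)))) n
        ≈⟨ +-congˡ (*-congˡ (⋆-swap α (∂ α) _ n)) ⟩
      X + (- 1#) * (∂ α ⋆ (α ⋆ A (suc (suc s)))) n
        -- The induction is on the length alone: the hypothesis is used at the larger parameter
        -- `suc s`.
        ≈⟨ +-congˡ (*-congˡ (⋆-cong-≤ n (λ _ _ → F.refl) (λ k k≤n → go N k (ℕₚ.≤-trans k≤n n≤N) (suc s)))) ⟩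
      X + (- 1#) * (∂ α ⋆ (ι (suc (suc s)) · A (suc s))) n
        ≈⟨ +-congˡ (*-congˡ (⋆-·ʳ _ (∂ α) _ n)) ⟩
      X + (- 1#) * ((1# + ι (suc s)) * X)
        ≈⟨ solve 3 (λ x e i → x :+ e :* ((con 1 :+ i) :* x) := (con 1 :+ e) :* x :+ i :* (e :* x)) F.refl X (- 1#) (ι (suc s)) ⟩
      (1# + - 1#) * X + ι (suc s) * ((- 1#) * X)
        ≈⟨ +-congʳ (F.trans (*-congʳ (-‿inverseʳ 1#)) (zeroˡ X)) ⟩
      0# + ι (suc s) * ((- 1#) * X)
        ≈⟨ +-identityˡ _ ⟩
      ι (suc s) * ((- 1#) * X)
        ≈⟨ *-congˡ (∂-partitionSum-reciprocal s α n) ⟨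
      ι (suc s) * A s (suc n) ∎
      where X = (∂ α ⋆ A (suc s)) n

  -- In positive degree, the derivative A′ A⁻¹ - A A′ A⁻² vanishes because A A⁻² = A⁻¹, the case s =
  -- 0 of `⋆-partitionSum-reciprocal`.
  ⋆-inverse : ∀ α → α 0 ≈ 1# → α ⋆ partitionSum (reciprocalWeight 0) α ≋ δ
  ⋆-inverse α α₀ zero = begin
    α 0 * partitionSum (reciprocalWeight 0) α 0   ≈⟨ *-cong α₀ (partitionSum-zero (reciprocalWeight 0) α) ⟩
    1# * (1# * (1# + 0#))          ≈⟨ solve 0 (con 1 :* (con 1 :* (con 1 :+ con 0)) := con 1) F.refl ⟩
    1#                             ∎
  ⋆-inverse α α₀ (suc n) = begin
    X + (α ⋆ ∂ (partitionSum (reciprocalWeight 0) α)) n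
      ≈⟨ +-congˡ (F.trans (⋆-congˡ (∂-partitionSum-reciprocal 0 α) n) (⋆-·ʳ (- 1#) α _ n)) ⟩
    X + (- 1#) * (α ⋆ (∂ α ⋆ partitionSum (reciprocalWeight 1) α)) n
      ≈⟨ +-congˡ (*-congˡ (⋆-swap α (∂ α) _ n)) ⟩
    X + (- 1#) * (∂ α ⋆ (α ⋆ partitionSum (reciprocalWeight 1) α)) n
      ≈⟨ +-congˡ (*-congˡ (F.trans (⋆-congˡ (⋆-partitionSum-reciprocal α α₀ 0) n) (⋆-·ʳ (ι 1) (∂ α) _ n))) ⟩
    X + (- 1#) * ((1# + 0#) * X)
      ≈⟨ solve 2 (λ x e → x :+ e :* ((con 1 :+ con 0) :* x) := (con 1 :+ e) :* x) F.refl X (- 1#) ⟩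
    (1# + - 1#) * X
      ≈⟨ F.trans (*-congʳ (-‿inverseʳ 1#)) (zeroˡ X) ⟩
    0# ∎
    where X = (∂ α ⋆ partitionSum (reciprocalWeight 0) α) n

  -- möbiusWeight |π| is the Möbius function μ(π, 1ₙ) of the partition lattice.
  möbiusWeight : Seq
  möbiusWeight zero    = 0#
  möbiusWeight (suc r) = sgn r * ι (r !)

  -- For α 0 = 1 these are log A and exp C. The value 0 of `möbiusWeight` at 0 is the constant term
  -- of log (1 + t).
  cumulant expSeq : Seq → Seq
  cumulant = partitionSum möbiusWeight
  expSeq   = partitionSum (λ _ → 1#)

  -- `∂ möbiusWeight` is definitionally `reciprocalWeight 0`, as the derivative of log (1 + t) is
  -- 1/(1 + t).
  ∂-cumulant : ∀ α → ∂ (cumulant α) ≋ ∂ α ⋆ partitionSum (reciprocalWeight 0) α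
  ∂-cumulant α = ∂-partitionSum möbiusWeight α

  ∂-expSeq : ∀ c → ∂ (expSeq c) ≋ ∂ c ⋆ expSeq c
  ∂-expSeq = ∂-partitionSum (λ _ → 1#)

  expSeq-zero : ∀ c → expSeq c 0 ≈ 1#
  expSeq-zero = partitionSum-zero (λ _ → 1#)

  -- Both sides solve y′ = (log A)′ y with y(0) = 1; for A this is A′ = (A′ A⁻¹) A.
  expSeq-cumulant : ∀ α → α 0 ≈ 1# → expSeq (cumulant α) ≋ α
  expSeq-cumulant α α₀ = linear-ode-unique (F.trans (expSeq-zero (cumulant α)) (F.sym α₀)) (∂-expSeq (cumulant α))
    λ n → begin
    α (suc n)                                    ≈⟨ ⋆-identityʳ (∂ α) n ⟨
    (∂ α ⋆ δ) n                                  ≈⟨ ⋆-congˡ (⋆-inverse α α₀) n ⟨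
    (∂ α ⋆ (α ⋆ partitionSum (reciprocalWeight 0) α)) n         ≈⟨ ⋆-swap α (∂ α) _ n ⟨
    (α ⋆ (∂ α ⋆ partitionSum (reciprocalWeight 0) α)) n         ≈⟨ ⋆-congˡ (∂-cumulant α) n ⟨
    (α ⋆ ∂ (cumulant α)) n                       ≈⟨ ⋆-comm α _ n ⟩
    (∂ (cumulant α) ⋆ α) n                       ∎

  -- Only derivatives are compared: `expSeq` does not see `c 0`, and a cumulant sequence always
  -- starts with 0.
  cumulant-expSeq : ∀ c → ∂ (cumulant (expSeq c)) ≋ ∂ c
  cumulant-expSeq c n = begin
    cumulant (expSeq c) (suc n)                  ≈⟨ ∂-cumulant (expSeq c) n ⟩
    (∂ (expSeq c) ⋆ partitionSum (reciprocalWeight 0) (expSeq c)) n ≈⟨ ⋆-congʳ (∂-expSeq c) n ⟩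
    ((∂ c ⋆ expSeq c) ⋆ partitionSum (reciprocalWeight 0) (expSeq c)) n ≈⟨ ⋆-assoc (∂ c) _ _ n ⟩
    (∂ c ⋆ (expSeq c ⋆ partitionSum (reciprocalWeight 0) (expSeq c))) n ≈⟨ ⋆-congˡ (⋆-inverse (expSeq c) (expSeq-zero c)) n ⟩
    (∂ c ⋆ δ) n                                  ≈⟨ ⋆-identityʳ (∂ c) n ⟩
    c (suc n)                                    ∎

  -- Sums over the refinements of a fixed partition

  [_] : Bool → Carrier
  [ true  ] = 1#
  [ false ] = 0#

  [∧] : ∀ a b → [ a ∧ b ] ≈ [ a ] * [ b ]
  [∧] true  b = F.sym (*-identityˡ _)
  [∧] false b = F.sym (zeroˡ _)

  -- Isolates one factor of a product without dividing by it.
  except : ℕ → Seq → Seq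
  except x a v = if v ≡ᵇ x then 1# else a v

  ∏<-one : ∀ K {a} → (∀ v → v ℕ.< K → a v ≈ 1#) → ∏< K a ≈ 1#
  ∏<-one zero    p = F.refl
  ∏<-one (suc K) p = F.trans (*-cong (∏<-one K (λ v lt → p v (ℕₚ.m≤n⇒m≤1+n lt))) (p K ℕₚ.≤-refl)) (*-identityˡ _)

  ∏<-except : ∀ K {x} a → x ℕ.< K → ∏< K a ≈ ∏< K (except x a) * a x
  ∏<-except (suc K) {x} a x<1+K with x ℕ.≟ K
  ... | yes refl rewrite ≡ᵇ-refl x = *-congʳ (F.trans (∏<-cong K same) (F.sym (*-identityʳ _)))
    where
    same : ∀ v → v ℕ.< K → a v ≈ except K a v
    same v v<K rewrite ≢⇒≡ᵇ-false (ℕₚ.<⇒≢ v<K) = F.refl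
  ... | no x≢K rewrite ≢⇒≡ᵇ-false (x≢K ∘ ≡.sym) = F.trans
      (*-congʳ (∏<-except K a (ℕₚ.≤∧≢⇒< (ℕₚ.≤-pred x<1+K) x≢K)))
      (solve 3 (λ p q r → (p :* q) :* r := (p :* r) :* q) F.refl _ _ _)

  except-cong : ∀ {x a b} → (∀ v → v ≢ x → a v ≈ b v) → except x a ≋ except x b
  except-cong {x} p v with v ℕ.≟ x
  ... | yes refl rewrite ≡ᵇ-refl x = F.refl
  ... | no v≢x rewrite ≢⇒≡ᵇ-false v≢x = p v v≢x

  ∏<-swap : ∀ K m (a : ℕ → ℕ → Carrier) → ∏< K (λ v → ∏< m (a v)) ≈ ∏< m (λ j → ∏< K (λ v → a v j))
  ∏<-swap zero    m a = F.sym (∏<-one m (λ _ _ → F.refl))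
  ∏<-swap (suc K) m a = F.trans (*-congʳ (∏<-swap K m a)) (∏<-* m _ _)

  -- The factors that belong to block v of the coarser partition: an open block lying elsewhere is
  -- replaced by the unit `δ` and drops out of `⨂<`.
  select : Dict → (ℕ → Seq) → ℕ → ℕ → Seq
  select φ f v j = if has (φ j) v then f j else δ

  record Labels (m K : ℕ) (φ : Dict) : Set where
    field
      used   : ∀ j → j ℕ.< m → ∃ λ u → φ j ≡ just u × u ℕ.< K
      unused : ∀ j → m ≤ j → φ j ≡ nothing
  open Labels

  Labels-old : ∀ {m K φ j x} → j ℕ.< m → x ℕ.< K → Labels m K φ → Labels m K (upd φ j x)
  Labels-old {φ = φ} {j} {x} j<m x<K L .used i i<m with i ℕ.≟ j
  ... | yes refl = x , upd-≡ φ j x , x<K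
  ... | no i≢j   = let u , e , u<K = L .used i i<m in u , ≡.trans (upd-≢ φ x i≢j) e , u<K
  Labels-old {φ = φ} {j} {x} j<m x<K L .unused i m≤i =
    ≡.trans (upd-≢ φ x (ℕₚ.>⇒≢ (ℕₚ.<-≤-trans j<m m≤i))) (L .unused i m≤i)

  Labels-new : ∀ {m K φ x} → x ℕ.< K → Labels m K φ → Labels (suc m) K (upd φ m x)
  Labels-new {m} {φ = φ} {x} x<K L .used i i<1+m with i ℕ.≟ m
  ... | yes refl = x , upd-≡ φ m x , x<K
  ... | no i≢m   = let u , e , u<K = L .used i (ℕₚ.≤∧≢⇒< (ℕₚ.≤-pred i<1+m) i≢m) in u , ≡.trans (upd-≢ φ x i≢m) e , u<K
  Labels-new {m} {φ = φ} {x} x<K L .unused i m<i = ≡.trans (upd-≢ φ x (ℕₚ.>⇒≢ m<i)) (L .unused i (ℕₚ.<⇒≤ m<i))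

  select-upd-≢ : ∀ {φ g f j x v i} → i ≢ j → g i ≋ f i → select (upd φ j x) g v i ≋ select φ f v i
  select-upd-≢ {φ} {x = x} {v} {i} i≢j gf k rewrite upd-≢ φ x i≢j with has (φ i) v
  ... | true  = gf k
  ... | false = F.refl

  select-upd-other : ∀ φ g {j x v} → v ≢ x → select (upd φ j x) g v j ≋ δ
  select-upd-other φ g {j} {x} v≢x k rewrite upd-≡ φ j x | ≢⇒≡ᵇ-false (v≢x ∘ ≡.sym) = F.refl

  select-upd-self : ∀ φ g j x → select (upd φ j x) g x j ≋ g j
  select-upd-self φ g j x k rewrite upd-≡ φ j x | ≡ᵇ-refl x = F.refl

  ⨂<-annihilate : ∀ m f {j} → j ℕ.< m → f j ≋ 𝟘 → ⨂< m f ≋ 𝟘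
  ⨂<-annihilate (suc m) f {j} j<1+m z n with j ℕ.≟ m
  ... | yes refl = F.trans (⋆-congˡ z n) (⋆-zeroʳ _ n)
  ... | no j≢m   = F.trans (⋆-congʳ (⨂<-annihilate m f (ℕₚ.≤∧≢⇒< (ℕₚ.≤-pred j<1+m) j≢m) z) n) (⋆-zeroˡ _ n)

  -- Block j of s lies in the block φ j of r, so the sum factors over the blocks v of r.
  ∑-compatible : ∀ r m c f φ K → Default m c f → Labels m K φ → All (ℕ._< K) r →
    ∑ (partsFrom (length r) m) (λ s → [ compatible φ s r ] * blockProduct f m s) ≈
    ∏< K (λ v → (⨂< m (select φ f v) ⋆ expSeq c) (count v r))
  ∑-compatible [] m c f φ K df L [] = begin
    1# * ∏< (m ⊔ 0) (λ j → f j 0) + 0#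
      ≈⟨ F.trans (+-identityʳ _) (*-identityˡ _) ⟩
    ∏< (m ⊔ 0) (λ j → f j 0)
      ≡⟨ ≡.cong (λ k → ∏< k (λ j → f j 0)) (ℕₚ.⊔-identityʳ m) ⟩
    ∏< m (λ j → f j 0)
      ≈⟨ ∏<-cong m split ⟩
    ∏< m (λ j → ∏< K (λ v → select φ f v j 0))
      ≈⟨ ∏<-swap K m (λ v j → select φ f v j 0) ⟨
    ∏< K (λ v → ∏< m (λ j → select φ f v j 0))
      ≈⟨ ∏<-cong K (λ v _ → F.trans (*-cong (⨂<-zero m (select φ f v)) (expSeq-zero c)) (*-identityʳ _)) ⟨
    ∏< K (λ v → ⨂< m (select φ f v) 0 * expSeq c 0) ∎
    where
    split : ∀ j → j ℕ.< m → f j 0 ≈ ∏< K (λ v → select φ f v j 0)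
    split j j<m with L .used j j<m
    ... | u , e , u<K = F.sym (begin
      ∏< K (λ v → select φ f v j 0)
        ≈⟨ ∏<-except K _ u<K ⟩
      ∏< K (except u (λ v → select φ f v j 0)) * select φ f u j 0
        ≈⟨ *-cong (∏<-one K (λ v _ → others v)) self ⟩
      1# * f j 0
        ≈⟨ *-identityˡ _ ⟩
      f j 0 ∎)
      where
      self : select φ f u j 0 ≈ f j 0
      self rewrite e | ≡ᵇ-refl u = F.refl
      others : ∀ v → except u (λ v → select φ f v j 0) v ≈ 1#
      others v with v ℕ.≟ u
      ... | yes refl rewrite ≡ᵇ-refl u = F.refl
      ... | no v≢u rewrite ≢⇒≡ᵇ-false v≢u | e | ≢⇒≡ᵇ-false (v≢u ∘ ≡.sym) = F.refl
  ∑-compatible (x ∷ r) m c f φ K df L (x<K ∷ r<K) = begin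
    ∑ (partsFrom (suc n) m) g
      ≈⟨ ∑-partsFrom-suc n m g ⟩
    ∑< m (λ j → ∑ (partsFrom n m) (g ∘ (j ∷_))) + ∑ (partsFrom n (suc m)) (g ∘ (m ∷_))
      ≈⟨ +-cong (∑<-cong m olds) news ⟩
    ∑< m (λ j → R * (⨂< m (bump j fₓ) ⋆ E) k) + R * ((⨂< m fₓ ⋆ ∂ c) ⋆ E) k
      ≈⟨ +-cong (F.sym (∑<-*ˡ m _ R)) (*-congˡ (F.trans (⋆-assoc _ (∂ c) E k) (⋆-congˡ (λ i → F.sym (∂-expSeq c i)) k))) ⟩
    R * ∑< m (λ j → (⨂< m (bump j fₓ) ⋆ E) k) + R * (⨂< m fₓ ⋆ ∂ E) k
      ≈⟨ distribˡ R _ _ ⟨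
    R * (∑< m (λ j → (⨂< m (bump j fₓ) ⋆ E) k) + (⨂< m fₓ ⋆ ∂ E) k)
      -- The Leibniz rule read backwards: the two kinds of first letter together differentiate the
      -- factor of block x of r, while `R` collects the untouched blocks.
      ≈⟨ *-congˡ (+-congʳ (F.trans (⋆-congʳ (⨂<-leibniz m fₓ) k) (⋆-∑<ˡ m (λ j → ⨂< m (bump j fₓ)) E k))) ⟨
    R * (H x (suc k))
      ≈⟨ *-cong (∏<-cong K (λ v _ → except-cong atOther v)) atSelf ⟩
    ∏< K (except x (λ v → H v (count v (x ∷ r)))) * H x (count x (x ∷ r))
      ≈⟨ ∏<-except K _ x<K ⟨
    ∏< K (λ v → H v (count v (x ∷ r))) ∎
    where
    n = length r
    k = count x r
    E = expSeq c
    fₓ = select φ f x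
    g : List ℕ → Carrier
    g s = [ compatible φ s (x ∷ r) ] * blockProduct f m s
    H : ℕ → Seq
    H v = ⨂< m (select φ f v) ⋆ E
    R = ∏< K (except x (λ v → H v (count v r)))
    atOther : ∀ v → v ≢ x → H v (count v r) ≈ H v (count v (x ∷ r))
    atOther v v≢x rewrite ≢⇒≡ᵇ-false v≢x = F.refl
    atSelf : H x (suc k) ≈ H x (count x (x ∷ r))
    atSelf rewrite ≡ᵇ-refl x = F.refl
    regroup : ∀ m′ h ψ → (∀ v → v ≢ x → ⨂< m′ (select ψ h v) ≋ ⨂< m (select φ f v)) →
              ∏< K (λ v → (⨂< m′ (select ψ h v) ⋆ E) (count v r)) ≈ R * (⨂< m′ (select ψ h x) ⋆ E) k
    regroup m′ h ψ p = F.trans (∏<-except K _ x<K)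
      (*-congʳ (∏<-cong K (λ v _ → except-cong (λ v v≢x → ⋆-congʳ (p v v≢x) (count v r)) v)))
    news : ∑ (partsFrom n (suc m)) (g ∘ (m ∷_)) ≈ R * ((⨂< m fₓ ⋆ ∂ c) ⋆ E) k
    news = begin
      ∑ (partsFrom n (suc m)) (g ∘ (m ∷_))
        ≈⟨ ∑-cong (partsFrom n (suc m)) (λ s _ → unfold s) ⟩
      ∑ (partsFrom n (suc m)) (λ s → [ compatible (upd φ m x) s r ] * blockProduct (bump m f) (suc m) s)
        ≈⟨ ∑-compatible r (suc m) c (bump m f) (upd φ m x) K (Default-bump-new df) (Labels-new x<K L) r<K ⟩
      ∏< K (λ v → (⨂< (suc m) (select (upd φ m x) (bump m f) v) ⋆ E) (count v r))
        ≈⟨ regroup (suc m) (bump m f) (upd φ m x) other ⟩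
      R * (⨂< (suc m) (select (upd φ m x) (bump m f) x) ⋆ E) k
        ≈⟨ *-congˡ (⋆-congʳ (⋆-cong (below x) last) k) ⟩
      R * ((⨂< m fₓ ⋆ ∂ c) ⋆ E) k ∎
      where
      unfold : ∀ s → g (m ∷ s) ≈ [ compatible (upd φ m x) s r ] * blockProduct (bump m f) (suc m) s
      unfold s rewrite L .unused m ℕₚ.≤-refl = *-congˡ (F.reflexive (blockProduct-new f m s))
      below : ∀ v → ⨂< m (select (upd φ m x) (bump m f) v) ≋ ⨂< m (select φ f v)
      below v = ⨂<-cong m (λ j j<m → select-upd-≢ {φ} {bump m f} {f} (ℕₚ.<⇒≢ j<m) (bump-≢ f (ℕₚ.<⇒≢ j<m)))
      last : select (upd φ m x) (bump m f) x m ≋ ∂ c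
      last i = F.trans (select-upd-self φ (bump m f) m x i) (F.trans (bump-≡ m f i) (df m ℕₚ.≤-refl (suc i)))
      other : ∀ v → v ≢ x → ⨂< (suc m) (select (upd φ m x) (bump m f) v) ≋ ⨂< m (select φ f v)
      other v v≢x i = F.trans (⋆-cong (below v) (select-upd-other φ (bump m f) {m} v≢x) i) (⋆-identityʳ _ i)

    olds : ∀ j → j ℕ.< m → ∑ (partsFrom n m) (g ∘ (j ∷_)) ≈ R * (⨂< m (bump j fₓ) ⋆ E) k
    olds j j<m with L .used j j<m
    ... | u , e , u<K with u ℕ.≟ x
    -- Block j already lies in block u ≠ x of r. The summands are incompatible, and on the other
    -- side j carries `δ`, whose derivative is 0.
    ...   | no u≢x = begin
      ∑ (partsFrom n m) (g ∘ (j ∷_))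
        ≈⟨ ∑-cong (partsFrom n m) (λ s _ → vanish s) ⟩
      ∑ (partsFrom n m) (λ _ → 0#)
        ≈⟨ ∑-zero (partsFrom n m) ⟩
      0#
        ≈⟨ zeroʳ R ⟨
      R * 0#
        ≈⟨ *-congˡ (F.trans (⋆-congʳ (⨂<-annihilate m (bump j fₓ) j<m dead) k) (⋆-zeroˡ E k)) ⟨
      R * (⨂< m (bump j fₓ) ⋆ E) k ∎
      where
      vanish : ∀ s → g (j ∷ s) ≈ 0#
      vanish s rewrite e | ≢⇒≡ᵇ-false u≢x = zeroˡ _
      dead : bump j fₓ j ≋ 𝟘
      dead i = F.trans (bump-≡ j fₓ i) δ-next
        where
        δ-next : ∂ (select φ f x j) i ≈ 0#
        δ-next rewrite e | ≢⇒≡ᵇ-false u≢x = F.refl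
    ...   | yes refl = begin
      ∑ (partsFrom n m) (g ∘ (j ∷_))
        ≈⟨ ∑-cong (partsFrom n m) (λ s _ → unfold s) ⟩
      ∑ (partsFrom n m) (λ s → [ compatible (upd φ j x) s r ] * blockProduct (bump j f) m s)
        ≈⟨ ∑-compatible r m c (bump j f) (upd φ j x) K (Default-bump-old j<m df) (Labels-old j<m x<K L) r<K ⟩
      ∏< K (λ v → (⨂< m (select (upd φ j x) (bump j f) v) ⋆ E) (count v r))
        ≈⟨ regroup m (bump j f) (upd φ j x) (λ v v≢x → ⨂<-cong m (λ i _ → other v v≢x i)) ⟩
      R * (⨂< m (select (upd φ j x) (bump j f) x) ⋆ E) k
        ≈⟨ *-congˡ (⋆-congʳ (⨂<-cong m (λ i _ → self i)) k) ⟩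
      R * (⨂< m (bump j fₓ) ⋆ E) k ∎
      where
      unfold : ∀ s → g (j ∷ s) ≈ [ compatible (upd φ j x) s r ] * blockProduct (bump j f) m s
      unfold s rewrite e | ≡ᵇ-refl x = *-congˡ (F.reflexive (blockProduct-old f s j<m))
      other : ∀ v → v ≢ x → ∀ i → select (upd φ j x) (bump j f) v i ≋ select φ f v i
      other v v≢x i with i ℕ.≟ j
      ... | no i≢j = select-upd-≢ {φ} {bump j f} {f} i≢j (bump-≢ f i≢j)
      ... | yes refl = λ l → F.trans (select-upd-other φ (bump j f) {j} v≢x l) (F.sym (is-δ l))
        where
        is-δ : select φ f v j ≋ δ
        is-δ l rewrite e | ≢⇒≡ᵇ-false (v≢x ∘ ≡.sym) = F.refl
      self : ∀ i → select (upd φ j x) (bump j f) x i ≋ bump j fₓ i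
      self i with i ℕ.≟ j
      ... | no i≢j = λ l → F.trans (select-upd-≢ {φ} {bump j f} {f} i≢j (bump-≢ f i≢j) l) (F.sym (bump-≢ fₓ i≢j l))
      ... | yes refl = λ l → F.trans (select-upd-self φ (bump j f) j x l)
                             (F.trans (bump-≡ j f l) (F.sym (F.trans (bump-≡ j fₓ l) (is-f (suc l)))))
        where
        is-f : select φ f x j ≋ f j
        is-f l rewrite e | ≡ᵇ-refl x = F.refl

  -- The indicator of σ ∨ τ = 1 as a Möbius sum

  ∑<-single : ∀ m {a u} → u < m → (∀ j → j < m → j ≢ u → a j ≈ 0#) → ∑< m a ≈ a u
  ∑<-single (suc m) {a} {u} u< z with u ℕ.≟ m
  ... | yes refl = F.trans (+-congʳ (∑<-zero m (λ j j< → z j (ℕₚ.m≤n⇒m≤1+n j<) (ℕₚ.<⇒≢ j<)))) (+-identityˡ _)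
  ... | no u≢m   = F.trans (+-cong (∑<-single m (ℕₚ.≤∧≢⇒< (ℕₚ.≤-pred u<) u≢m) (λ j j< → z j (ℕₚ.m≤n⇒m≤1+n j<)))
                                   (z m ℕₚ.≤-refl (u≢m ∘ ≡.sym))) (+-identityʳ _)

  ∑<-const : ∀ m a → ∑< m (λ _ → a) ≈ ι m * a
  ∑<-const zero    a = F.sym (zeroˡ a)
  ∑<-const (suc m) a = F.trans (+-congʳ (∑<-const m a))
    (solve 2 (λ i x → i :* x :+ x := (con 1 :+ i) :* x) F.refl (ι m) a)

  ∑-vanish : ∀ {A : Set} (xs : List A) {f : A → Carrier} → (∀ x → x ∈ xs → f x ≈ 0#) → ∑ xs f ≈ 0#
  ∑-vanish xs p = F.trans (∑-cong xs p) (∑-zero xs)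

  -- Now the finer string `t` is fixed and the coarser one varies, the reverse of `∑-compatible`.
  -- Any labelling may serve as `t`, in particular the one that `join` returns.
  weightedCoarsenings : Seq → Dict → List ℕ → ℕ → Carrier
  weightedCoarsenings w φ t m =
    ∑ (partsFrom (length t) m) (λ r → [ compatible φ t r ] * w (m ⊔ nBlocks r))

  weightedCoarsenings-∷ : ∀ w φ x t m → weightedCoarsenings w φ (x ∷ t) m ≈
    ∑< m (λ j → [ match (φ x) j ] * weightedCoarsenings w (upd φ x j) t m)
    + [ match (φ x) m ] * weightedCoarsenings w (upd φ x m) t (suc m)
  weightedCoarsenings-∷ w φ x t m = F.trans (∑-partsFrom-suc (length t) m _)
    (+-cong (∑<-cong m (λ j j<m → pull j m (λ r → ⊔-nBlocks-old r j<m)))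
            (pull m (suc m) (⊔-nBlocks-new m)))
    where
    pull : ∀ j m′ → (∀ r → m ⊔ nBlocks (j ∷ r) ≡ m′ ⊔ nBlocks r) →
      ∑ (partsFrom (length t) m′) (λ r → [ compatible φ (x ∷ t) (j ∷ r) ] * w (m ⊔ nBlocks (j ∷ r)))
        ≈ [ match (φ x) j ] * weightedCoarsenings w (upd φ x j) t m′
    pull j m′ e = F.trans
      (∑-cong (partsFrom (length t) m′) (λ r _ →
        F.trans (*-cong ([∧] (match (φ x) j) _) (F.reflexive (≡.cong w (e r)))) (*-assoc _ _ _)))
      (F.sym (∑-*ˡ (partsFrom (length t) m′) _ _))

  Bounded : Dict → ℕ → Set
  Bounded φ m = ∀ y u → φ y ≡ just u → u < m

  Bounded-upd : ∀ φ x {m m′ j} → m ≤ m′ → j < m′ → Bounded φ m → Bounded (upd φ x j) m′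
  Bounded-upd φ x {j = j} m≤m′ j< b y u e with y ℕ.≟ x
  ... | yes refl = ≡.subst (_< _) (just-injective (≡.trans (≡.sym (upd-≡ φ x j)) e)) j<
  ... | no y≢x   = ℕₚ.<-≤-trans (b y u (≡.trans (≡.sym (upd-≢ φ j y≢x)) e)) m≤m′

  Seen : Dict → ℕ → Set
  Seen φ y = ∃ λ u → φ y ≡ just u

  Seen-upd : ∀ φ x j {y} → Seen φ y → Seen (upd φ x j) y
  Seen-upd φ x j {y} (u , e) with y ℕ.≟ x
  ... | yes refl = j , upd-≡ φ x j
  ... | no y≢x   = u , ≡.trans (upd-≢ φ j y≢x) e

  -- Labels recorded in `φ` force every letter, so a single coarsening is left and it opens no
  -- block.
  weightedCoarsenings-seen : ∀ w φ t m → Bounded φ m → All (Seen φ) t → weightedCoarsenings w φ t m ≈ w m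
  weightedCoarsenings-seen w φ [] m b [] = F.trans (+-identityʳ _)
    (F.trans (*-identityˡ _) (F.reflexive (≡.cong w (ℕₚ.⊔-identityʳ m))))
  weightedCoarsenings-seen w φ (x ∷ t) m b ((u , e) ∷ sn) = begin
    weightedCoarsenings w φ (x ∷ t) m
      ≈⟨ weightedCoarsenings-∷ w φ x t m ⟩
    ∑< m a + [ match (φ x) m ] * weightedCoarsenings w (upd φ x m) t (suc m)
      ≈⟨ +-cong (∑<-single m (b x u e) zeros) (dead m (ℕₚ.>⇒≢ (b x u e)) _) ⟩
    a u + 0#
      ≈⟨ +-identityʳ _ ⟩
    [ match (φ x) u ] * weightedCoarsenings w (upd φ x u) t m
      ≈⟨ *-cong alive (weightedCoarsenings-seen w (upd φ x u) t m
           (Bounded-upd φ x ℕₚ.≤-refl (b x u e) b) (All.map (Seen-upd φ x u) sn)) ⟩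
    1# * w m
      ≈⟨ *-identityˡ _ ⟩
    w m ∎
    where
    a : Seq
    a j = [ match (φ x) j ] * weightedCoarsenings w (upd φ x j) t m
    dead : ∀ j → j ≢ u → ∀ y → [ match (φ x) j ] * y ≈ 0#
    dead j j≢u y rewrite e | ≢⇒≡ᵇ-false (j≢u ∘ ≡.sym) = zeroˡ y
    alive : [ match (φ x) u ] ≈ 1#
    alive rewrite e | ≡ᵇ-refl u = F.refl
    zeros : ∀ j → j < m → j ≢ u → a j ≈ 0#
    zeros j _ j≢u = dead j j≢u _

  möbiusWeight-recurrence : ∀ m → ι (suc m) * möbiusWeight (suc m) + möbiusWeight (suc (suc m)) ≈ 0#
  möbiusWeight-recurrence m = begin
    ι (suc m) * (sgn m * ι (m !)) + ((- 1#) * sgn m) * ι (suc m !)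
      ≈⟨ +-congˡ (*-congˡ (ι-* (suc m) (m !))) ⟩
    ι (suc m) * (sgn m * ι (m !)) + ((- 1#) * sgn m) * (ι (suc m) * ι (m !))
      ≈⟨ solve 4 (λ i s f e → i :* (s :* f) :+ (e :* s) :* (i :* f) := (con 1 :+ e) :* (i :* (s :* f)))
           F.refl (ι (suc m)) (sgn m) (ι (m !)) (- 1#) ⟩
    (1# + - 1#) * (ι (suc m) * (sgn m * ι (m !)))
      ≈⟨ F.trans (*-congʳ (-‿inverseʳ 1#)) (zeroˡ _) ⟩
    0# ∎

  Unseen : Dict → ℕ → Set
  Unseen φ y = φ y ≡ nothing

  unseen? : ∀ φ y → Dec (Unseen φ y)
  unseen? φ y with φ y
  ... | nothing = yes refl
  ... | just _  = no λ ()

  ¬Unseen⇒Seen : ∀ φ y → ¬ Unseen φ y → Seen φ y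
  ¬Unseen⇒Seen φ y ¬u with φ y
  ... | nothing = ⊥-elim (¬u refl)
  ... | just u  = u , refl

  Unseen-upd : ∀ φ x j {y} → y ≢ x → Unseen φ y → Unseen (upd φ x j) y
  Unseen-upd φ x j y≢x e = ≡.trans (upd-≢ φ j y≢x) e

  -- Only the last new label of t matters: it joins one of the m blocks present
  -- or forms a new one, and m μₘ + μₘ₊₁ = 0.
  weightedCoarsenings-unseen : ∀ φ t m → Bounded φ (suc m) → Any (Unseen φ) t →
    weightedCoarsenings möbiusWeight φ t (suc m) ≈ 0#
  weightedCoarsenings-unseen φ (x ∷ t) m b un with any? (λ y → ¬? (y ℕ.≟ x) ×-dec unseen? φ y) t
  ... | yes more = begin
    weightedCoarsenings möbiusWeight φ (x ∷ t) (suc m)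
      ≈⟨ weightedCoarsenings-∷ möbiusWeight φ x t (suc m) ⟩
    _
      ≈⟨ +-cong (∑<-zero (suc m) λ j j< → kill (weightedCoarsenings-unseen (upd φ x j) t m
                   (Bounded-upd φ x ℕₚ.≤-refl j< b) (still j)))
                (kill (weightedCoarsenings-unseen (upd φ x (suc m)) t (suc m)
                   (Bounded-upd φ x (ℕₚ.n≤1+n _) ℕₚ.≤-refl b) (still (suc m)))) ⟩
    0# + 0#
      ≈⟨ +-identityʳ _ ⟩
    0# ∎
    where
    kill : ∀ {a y} → y ≈ 0# → a * y ≈ 0#
    kill p = F.trans (*-congˡ p) (zeroʳ _)
    still : ∀ j → Any (Unseen (upd φ x j)) t
    still j = Any.map (λ { {y} (y≢x , e) → Unseen-upd φ x j {y} y≢x e }) more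
  -- `x` is the only new label left and the rest is forced: each of the `suc m` blocks that `x` may
  -- join contributes the same weight, a new block the next one. With no block present the sum would
  -- be `möbiusWeight 1`, that is 1, hence `suc m`.
  ... | no none = begin
    weightedCoarsenings möbiusWeight φ (x ∷ t) (suc m)
      ≈⟨ weightedCoarsenings-∷ möbiusWeight φ x t (suc m) ⟩
    _
      ≈⟨ +-cong (∑<-cong (suc m) λ j j< → free (weightedCoarsenings-seen möbiusWeight (upd φ x j) t (suc m)
                   (Bounded-upd φ x ℕₚ.≤-refl j< b) (seen j)))
                (free (weightedCoarsenings-seen möbiusWeight (upd φ x (suc m)) t (suc (suc m))
                   (Bounded-upd φ x (ℕₚ.n≤1+n _) ℕₚ.≤-refl b) (seen (suc m)))) ⟩
    ∑< (suc m) (λ _ → möbiusWeight (suc m)) + möbiusWeight (suc (suc m))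
      ≈⟨ +-congʳ (∑<-const (suc m) _) ⟩
    ι (suc m) * möbiusWeight (suc m) + möbiusWeight (suc (suc m))
      ≈⟨ möbiusWeight-recurrence m ⟩
    0# ∎
    where
    x-unseen : Any (Unseen φ) (x ∷ t) → Unseen φ x
    x-unseen (here e)   = e
    x-unseen (there un) with unseen? φ x
    ... | yes e = e
    ... | no ¬e = ⊥-elim (none (Any.map (λ {y} e → (λ { refl → ¬e e }) , e) un))
    free : ∀ {j y z} → y ≈ z → [ match (φ x) j ] * y ≈ z
    free p rewrite x-unseen un = F.trans (*-identityˡ _) p
    seen : ∀ j → All (Seen (upd φ x j)) t
    seen j = All.map step (Allₚ.¬Any⇒All¬ t none)
      where
      step : ∀ {y} → ¬ (y ≢ x × Unseen φ y) → Seen (upd φ x j) y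
      step {y} ¬p with y ℕ.≟ x
      ... | yes refl = j , upd-≡ φ x j
      ... | no y≢x   = let u , e = ¬Unseen⇒Seen φ y (λ e → ¬p (y≢x , e)) in u , ≡.trans (upd-≢ φ j y≢x) e

  -- Only the string of zeros survives, and it opens no block because label 0 is already in use.
  ∑-isOne : ∀ n m (w : Seq) → ∑ (partsFrom n (suc m)) (λ s → [ isOne s ] * w (suc m ⊔ nBlocks s)) ≈ w (suc m)
  ∑-isOne zero    m w = F.trans (+-identityʳ _) (*-identityˡ _)
  ∑-isOne (suc n) m w = begin
    ∑ (partsFrom (suc n) (suc m)) g
      ≈⟨ ∑-partsFrom-suc n (suc m) g ⟩
    ∑< (suc m) (λ j → ∑ (partsFrom n (suc m)) (g ∘ (j ∷_))) + ∑ (partsFrom n (suc (suc m))) (g ∘ (suc m ∷_))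
      ≈⟨ +-cong (∑<-single (suc m) {u = 0} (s≤s z≤n) λ { zero _ 0≢0 → ⊥-elim (0≢0 refl)
                                                 ; (suc j) _ _ → ∑-vanish (partsFrom n (suc m)) (λ _ _ → zeroˡ _) })
                (∑-vanish (partsFrom n (suc (suc m))) (λ _ _ → zeroˡ _)) ⟩
    ∑ (partsFrom n (suc m)) (g ∘ (0 ∷_)) + 0#
      ≈⟨ +-identityʳ _ ⟩
    ∑ (partsFrom n (suc m)) (g ∘ (0 ∷_))
      ≈⟨ ∑-cong (partsFrom n (suc m)) (λ s _ → *-congˡ (F.reflexive (≡.cong w (⊔-nBlocks-old {suc m} s (s≤s z≤n))))) ⟩
    ∑ (partsFrom n (suc m)) (λ s → [ isOne s ] * w (suc m ⊔ nBlocks s))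
      ≈⟨ ∑-isOne n m w ⟩
    w (suc m) ∎
    where
    g : List ℕ → Carrier
    g s = [ isOne s ] * w (suc m ⊔ nBlocks s)

  isOne⇒≤ᴾ : ∀ s r → isOne r ≡ true → s ≤ᴾ r ≡ true
  isOne⇒≤ᴾ s r e = Functional⇒≤ᴾ s r λ p∈ q∈ _ → ≡.trans (zeros s r e p∈) (≡.sym (zeros s r e q∈))
    where
    zeros : ∀ s r → isOne r ≡ true → ∀ {p} → p ∈ zip s r → proj₂ p ≡ 0
    zeros (x ∷ s) (y ∷ r) e (here refl) = ≡ᵇ-true⇒≡ (proj₁ (∧-true⁻ {y ≡ᵇ 0} e))
    zeros (x ∷ s) (y ∷ r) e (there p∈)  = zeros s r (proj₂ (∧-true⁻ {y ≡ᵇ 0} e)) p∈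

  -- The extra pair stands for the first letters, as a nonempty growth string starts with 0.
  constant⇒isOne : ∀ {n x} t r → length t ≡ n → length r ≡ n → All (_≡ x) t →
    Functional ((x , 0) ∷ zip t r) → isOne r ≡ true
  constant⇒isOne []      []      lt   lr [] fn = refl
  constant⇒isOne []      (_ ∷ _) refl () [] fn
  constant⇒isOne (x ∷ t) (y ∷ r) refl lr (refl ∷ cs) fn = ∧-true⁺
    (≡⇒≡ᵇ-true (fn (there (here refl)) (here refl) refl))
    (constant⇒isOne t r refl (ℕₚ.suc-injective lr) cs fn′)
    where
    fn′ : Functional ((x , 0) ∷ zip t r)
    fn′ (here p) (here q) = fn (here p) (here q)
    fn′ (here p) (there q) = fn (here p) (there (there q))
    fn′ (there p) (here q) = fn (there (there p)) (here q)
    fn′ (there p) (there q) = fn (there (there p)) (there (there q))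

  -- `joinIsOne` speaks only of upper bounds. If it holds, the one-block partition is the only term,
  -- with μ(1ₙ,1ₙ) = 1. If it fails, some upper bound ρ₀ ≠ 1ₙ shows that the labelling of σ ∨ τ is
  -- not constant; a label is then still unseen after the first letter, and the sum cancels.
  joinIsOne-sum : ∀ n {σ τ} → length σ ≡ suc n → length τ ≡ suc n →
    [ joinIsOne (suc n) σ τ ] ≈ ∑ (P (suc n)) (λ ρ → [ (σ ≤ᴾ ρ) ∧ (τ ≤ᴾ ρ) ] * möbiusWeight (nBlocks ρ))
  joinIsOne-sum n {σ} {τ} lσ lτ with joinIsOne (suc n) σ τ in e
  ... | true = F.sym (begin
    ∑ (P (suc n)) (λ ρ → [ (σ ≤ᴾ ρ) ∧ (τ ≤ᴾ ρ) ] * möbiusWeight (nBlocks ρ))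
      ≈⟨ ∑-cong (P (suc n)) (λ ρ ρ∈ → *-congʳ (F.reflexive (≡.cong [_] (Boolₚ.⇔→≡ {z = true} (mk⇔
           (implies⁻ {(σ ≤ᴾ ρ) ∧ (τ ≤ᴾ ρ)} (allB⁻ e ρ∈))
           (λ e₁ → ∧-true⁺ (isOne⇒≤ᴾ σ ρ e₁) (isOne⇒≤ᴾ τ ρ e₁))))))) ⟩
    ∑ (P (suc n)) (λ ρ → [ isOne ρ ] * möbiusWeight (nBlocks ρ))
      ≈⟨ ∑-partsFrom-suc n 0 _ ⟩
    0# + ∑ (partsFrom n 1) (λ ρ → [ isOne ρ ] * möbiusWeight (nBlocks (0 ∷ ρ)))
      ≈⟨ +-identityˡ _ ⟩
    ∑ (partsFrom n 1) (λ ρ → [ isOne ρ ] * möbiusWeight (nBlocks (0 ∷ ρ)))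
      ≈⟨ ∑-cong (partsFrom n 1) (λ ρ _ → *-congˡ (F.reflexive (≡.cong möbiusWeight (nBlocks-∷ 0 ρ)))) ⟩
    ∑ (partsFrom n 1) (λ ρ → [ isOne ρ ] * möbiusWeight (1 ⊔ nBlocks ρ))
      ≈⟨ ∑-isOne n 0 möbiusWeight ⟩
    1# * (1# + 0#)
      ≈⟨ solve 0 (con 1 :* (con 1 :+ con 0) := con 1) F.refl ⟩
    1# ∎)
  ... | false with join σ τ lσ lτ | allB-false (P (suc n)) e
  ...   | [] , () , _ | _
  ...   | x ∷ t , lt , spec | ρ₀ , ρ₀∈ , e₀ = F.sym (begin
    ∑ (P (suc n)) (λ ρ → [ (σ ≤ᴾ ρ) ∧ (τ ≤ᴾ ρ) ] * möbiusWeight (nBlocks ρ))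
      ≈⟨ ∑-cong (P (suc n)) (λ ρ ρ∈ → *-congʳ (F.reflexive (≡.cong [_]
           (≡.trans (spec ρ (growth-length (∈-partsFrom (suc n) 0 ρ∈))) (≤ᴾ-compatible (x ∷ t) ρ))))) ⟩
    ∑ (P (suc n)) (λ ρ → [ compatible ∅ (x ∷ t) ρ ] * möbiusWeight (nBlocks ρ))
      ≡⟨ ≡.cong (λ k → ∑ (P k) (λ ρ → [ compatible ∅ (x ∷ t) ρ ] * möbiusWeight (nBlocks ρ))) lt ⟨
    weightedCoarsenings möbiusWeight ∅ (x ∷ t) 0
      -- The first letter of ρ is 0; removing it leaves one open block, as
      -- `weightedCoarsenings-unseen` requires.
      ≈⟨ weightedCoarsenings-∷ möbiusWeight ∅ x t 0 ⟩
    0# + 1# * weightedCoarsenings möbiusWeight (upd ∅ x 0) t 1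
      ≈⟨ +-congˡ (*-congˡ (weightedCoarsenings-unseen (upd ∅ x 0) t 0
           (Bounded-upd ∅ x {m = 0} z≤n (s≤s z≤n) (λ _ _ ())) unseen)) ⟩
    0# + 1# * 0#
      ≈⟨ F.trans (+-identityˡ _) (zeroʳ _) ⟩
    0# ∎)
    where
    coarsening₀ : (σ ≤ᴾ ρ₀) ∧ (τ ≤ᴾ ρ₀) ≡ true × isOne ρ₀ ≡ false
    coarsening₀ with (σ ≤ᴾ ρ₀) ∧ (τ ≤ᴾ ρ₀)
    ... | true = refl , e₀
    notConstant : ¬ All (_≡ x) t
    notConstant cs with ∈-partsFrom (suc n) 0 ρ₀∈
    ... | fresh {s = s} g with ≡.trans (≡.sym (proj₂ coarsening₀)) 
             (constant⇒isOne t s (ℕₚ.suc-injective lt) (growth-length g) cs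
             (≤ᴾ⇒Functional (x ∷ t) (0 ∷ s) (≡.trans (≡.sym (spec (0 ∷ s) (≡.cong suc (growth-length g)))) (proj₁ coarsening₀))))
    ... | ()
    unseen : Any (Unseen (upd ∅ x 0)) t
    unseen with any? (λ y → ¬? (y ℕ.≟ x)) t
    ... | yes un = Any.map (λ {y} y≢x → upd-≢ ∅ {x} {y} 0 y≢x) un
    ... | no ¬un = ⊥-elim (notConstant (All.map (λ {y} ¬¬e → dec y ¬¬e) (Allₚ.¬Any⇒All¬ t ¬un)))
      where
      dec : ∀ y → ¬ (y ≢ x) → y ≡ x
      dec y ¬¬e with y ℕ.≟ x
      ... | yes e = e
      ... | no ¬e = ⊥-elim (¬¬e ¬e)

  -- Cumulants of a product

  infixl 7 _⊙_
  _⊙_ : Seq → Seq → Seq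
  (f ⊙ g) n = f n * g n

  multiplicative : Seq → List ℕ → Carrier
  multiplicative c = blockProduct (λ _ → c) 0

  -- A refinement of ρ is an independent choice of a partition of each block of ρ; this is
  -- `∑-compatible` with no block open yet.
  ∑-refinements : ∀ n c {ρ} → ρ ∈ P n →
    ∑ (P n) (λ σ → [ σ ≤ᴾ ρ ] * multiplicative c σ) ≈ multiplicative (expSeq c) ρ
  ∑-refinements n c {ρ} ρ∈ = begin
    ∑ (P n) (λ σ → [ σ ≤ᴾ ρ ] * multiplicative c σ)
      ≈⟨ ∑-cong (P n) (λ σ _ → *-congʳ (F.reflexive (≡.cong [_] (≤ᴾ-compatible σ ρ)))) ⟩
    ∑ (P n) (λ σ → [ compatible ∅ σ ρ ] * multiplicative c σ)
      ≡⟨ ≡.cong (λ k → ∑ (P k) (λ σ → [ compatible ∅ σ ρ ] * multiplicative c σ)) (growth-length (∈-partsFrom n 0 ρ∈)) ⟨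
    ∑ (P (length ρ)) (λ σ → [ compatible ∅ σ ρ ] * multiplicative c σ)
      ≈⟨ ∑-compatible ρ 0 c (λ _ → c) ∅ (nBlocks ρ) (λ _ _ _ → F.refl)
           (record { used = λ _ () ; unused = λ _ _ → refl }) (labels<nBlocks ρ) ⟩
    ∏< (nBlocks ρ) (λ v → (δ ⋆ expSeq c) (count v ρ))
      ≈⟨ ∏<-cong (nBlocks ρ) (λ v _ → ⋆-identityˡ (expSeq c) (count v ρ)) ⟩
    multiplicative (expSeq c) ρ ∎

  ∑-join-one : ∀ n c c′ →
    ∑ (P (suc n)) (λ σ → ∑ (P (suc n)) (λ τ →
      [ joinIsOne (suc n) σ τ ] * (multiplicative c σ * multiplicative c′ τ)))
    ≈ cumulant (expSeq c ⊙ expSeq c′) (suc n)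
  ∑-join-one n c c′ = begin
    ∑ Ps (λ σ → ∑ Ps (λ τ → [ joinIsOne (suc n) σ τ ] * (u σ * u′ τ)))
      ≈⟨ ∑-cong Ps (λ σ σ∈ → ∑-cong Ps (λ τ τ∈ → expand σ τ (len σ∈) (len τ∈))) ⟩
    ∑ Ps (λ σ → ∑ Ps (λ τ → ∑ Ps (λ ρ → T₃ ρ σ τ)))
      ≈⟨ ∑-cong Ps (λ σ _ → ∑-swap Ps Ps (λ τ ρ → T₃ ρ σ τ)) ⟩
    ∑ Ps (λ σ → ∑ Ps (λ ρ → ∑ Ps (λ τ → T₃ ρ σ τ)))
      ≈⟨ ∑-swap Ps Ps (λ σ ρ → ∑ Ps (T₃ ρ σ)) ⟩
    ∑ Ps (λ ρ → ∑ Ps (λ σ → ∑ Ps (λ τ → T₃ ρ σ τ)))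
      -- For fixed ρ the conditions on σ and τ decouple, so the double sum is a product of two sums.
      ≈⟨ ∑-cong Ps collect ⟩
    cumulant (expSeq c ⊙ expSeq c′) (suc n) ∎
    where
    Ps = P (suc n)
    w = möbiusWeight
    u = multiplicative c
    u′ = multiplicative c′
    a a′ : List ℕ → List ℕ → Carrier
    a ρ σ = [ σ ≤ᴾ ρ ] * u σ
    a′ ρ τ = [ τ ≤ᴾ ρ ] * u′ τ
    T₃ : List ℕ → List ℕ → List ℕ → Carrier
    T₃ ρ σ τ = w (nBlocks ρ) * (a ρ σ * a′ ρ τ)
    len : ∀ {σ} → σ ∈ Ps → length σ ≡ suc n
    len σ∈ = growth-length (∈-partsFrom (suc n) 0 σ∈)
    expand : ∀ σ τ → length σ ≡ suc n → length τ ≡ suc n →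
             [ joinIsOne (suc n) σ τ ] * (u σ * u′ τ) ≈ ∑ Ps (λ ρ → T₃ ρ σ τ)
    expand σ τ lσ lτ = begin
      [ joinIsOne (suc n) σ τ ] * (u σ * u′ τ)
        ≈⟨ *-congʳ (joinIsOne-sum n {σ} {τ} lσ lτ) ⟩
      ∑ Ps (λ ρ → [ (σ ≤ᴾ ρ) ∧ (τ ≤ᴾ ρ) ] * w (nBlocks ρ)) * (u σ * u′ τ)
        ≈⟨ ∑-*ʳ Ps _ _ ⟩
      ∑ Ps (λ ρ → [ (σ ≤ᴾ ρ) ∧ (τ ≤ᴾ ρ) ] * w (nBlocks ρ) * (u σ * u′ τ))
        ≈⟨ ∑-cong Ps (λ ρ _ → F.trans (*-congʳ (*-congʳ ([∧] (σ ≤ᴾ ρ) (τ ≤ᴾ ρ))))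
             (solve 5 (λ p q w x y → ((p :* q) :* w) :* (x :* y) := w :* ((p :* x) :* (q :* y))) F.refl _ _ _ _ _)) ⟩
      ∑ Ps (λ ρ → T₃ ρ σ τ) ∎
    collect : ∀ ρ → ρ ∈ Ps → ∑ Ps (λ σ → ∑ Ps (λ τ → T₃ ρ σ τ)) ≈ w (nBlocks ρ) * multiplicative (expSeq c ⊙ expSeq c′) ρ
    collect ρ ρ∈ = begin
      ∑ Ps (λ σ → ∑ Ps (λ τ → w (nBlocks ρ) * (a ρ σ * a′ ρ τ)))
        ≈⟨ ∑-cong Ps (λ σ _ → ∑-*ˡ Ps (w (nBlocks ρ)) _) ⟨
      ∑ Ps (λ σ → w (nBlocks ρ) * ∑ Ps (λ τ → a ρ σ * a′ ρ τ))
        ≈⟨ ∑-*ˡ Ps (w (nBlocks ρ)) _ ⟨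
      w (nBlocks ρ) * ∑ Ps (λ σ → ∑ Ps (λ τ → a ρ σ * a′ ρ τ))
        ≈⟨ *-congˡ (∑-cong Ps (λ σ _ → F.sym (∑-*ˡ Ps (a ρ σ) (a′ ρ)))) ⟩
      w (nBlocks ρ) * ∑ Ps (λ σ → a ρ σ * ∑ Ps (a′ ρ))
        ≈⟨ *-congˡ (F.sym (∑-*ʳ Ps _ (a ρ))) ⟩
      w (nBlocks ρ) * (∑ Ps (a ρ) * ∑ Ps (a′ ρ))
        ≈⟨ *-congˡ (*-cong (∑-refinements (suc n) c ρ∈) (∑-refinements (suc n) c′ ρ∈)) ⟩
      w (nBlocks ρ) * (multiplicative (expSeq c) ρ * multiplicative (expSeq c′) ρ)
        ≈⟨ *-congˡ (∏<-* (nBlocks ρ) _ _) ⟩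
      w (nBlocks ρ) * multiplicative (expSeq c ⊙ expSeq c′) ρ ∎

  -- Arithmetic in the field

  infixr 8 _^ᶠ_
  _^ᶠ_ : Carrier → ℕ → Carrier
  _^ᶠ_ = _^_ F

  infixl 7 _÷_
  _÷_ : Carrier → ℕ → Carrier
  _÷_ = _/ℕ_ F

  ι-nonzero : ∀ k .{{_ : NonZero k}} → ¬ (ι k ≈ 0#)
  ι-nonzero (suc k) = charZero k

  ι-inverseʳ : ∀ k .{{_ : NonZero k}} → ι k * inv (ι k) ≈ 1#
  ι-inverseʳ k = inverseʳ (ι k) (ι-nonzero k)

  ι-cancelˡ : ∀ k .{{_ : NonZero k}} {x y} → ι k * x ≈ ι k * y → x ≈ y
  ι-cancelˡ k {x} {y} e = begin
    x                        ≈⟨ undo x ⟨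
    inv (ι k) * (ι k * x)    ≈⟨ *-congˡ e ⟩
    inv (ι k) * (ι k * y)    ≈⟨ undo y ⟩
    y                        ∎
    where
    undo : ∀ z → inv (ι k) * (ι k * z) ≈ z
    undo z = F.trans (solve 3 (λ i k z → i :* (k :* z) := (k :* i) :* z) F.refl _ _ z)
                     (F.trans (*-congʳ (ι-inverseʳ k)) (*-identityˡ z))

  ι-÷ : ∀ k .{{_ : NonZero k}} x → ι k * (x ÷ k) ≈ x
  ι-÷ k x = F.trans (solve 3 (λ k x i → k :* (x :* i) := (k :* i) :* x) F.refl (ι k) x (inv (ι k)))
                    (F.trans (*-congʳ (ι-inverseʳ k)) (*-identityˡ x))

  ÷-unique : ∀ k .{{_ : NonZero k}} {x y} → ι k * y ≈ x → x ÷ k ≈ y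
  ÷-unique k {x} {y} e = ι-cancelˡ k (F.trans (ι-÷ k x) (F.sym e))

  inv-* : ∀ j k .{{_ : NonZero j}} .{{_ : NonZero k}} → ι j * inv (ι (j ℕ.* k)) ≈ inv (ι k)
  inv-* j k = ι-cancelˡ k (begin
    ι k * (ι j * inv (ι (j ℕ.* k)))   ≈⟨ solve 3 (λ k j i → k :* (j :* i) := (j :* k) :* i) F.refl (ι k) (ι j) _ ⟩
    (ι j * ι k) * inv (ι (j ℕ.* k))   ≈⟨ *-congʳ (ι-* j k) ⟨
    ι (j ℕ.* k) * inv (ι (j ℕ.* k))   ≈⟨ ι-inverseʳ (j ℕ.* k) {{ℕₚ.m*n≢0 j k}} ⟩
    1#                                ≈⟨ ι-inverseʳ k ⟨
    ι k * inv (ι k)                   ∎)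

  ^-+ : ∀ x m n → x ^ᶠ (m ℕ.+ n) ≈ x ^ᶠ m * x ^ᶠ n
  ^-+ x zero    n = F.sym (*-identityˡ _)
  ^-+ x (suc m) n = F.trans (*-congˡ (^-+ x m n)) (F.sym (*-assoc _ _ _))

  ^-* : ∀ x y n → (x * y) ^ᶠ n ≈ x ^ᶠ n * y ^ᶠ n
  ^-* x y zero    = F.sym (*-identityˡ _)
  ^-* x y (suc n) = F.trans (*-congˡ (^-* x y n))
    (solve 4 (λ x y p q → (x :* y) :* (p :* q) := (x :* p) :* (y :* q)) F.refl x y _ _)

  ^-cong : ∀ {x y} n → x ≈ y → x ^ᶠ n ≈ y ^ᶠ n
  ^-cong zero    e = F.refl
  ^-cong (suc n) e = *-cong e (^-cong n e)

  1^ : ∀ n → 1# ^ᶠ n ≈ 1#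
  1^ zero    = F.refl
  1^ (suc n) = F.trans (*-identityˡ _) (1^ n)

  ι-^ : ∀ d n → ι (d ℕ.^ n) ≈ ι d ^ᶠ n
  ι-^ d zero    = +-identityʳ 1#
  ι-^ d (suc n) = F.trans (ι-* d (d ℕ.^ n)) (*-congˡ (ι-^ d n))

  -1*-1≈1 : (- 1#) * (- 1#) ≈ 1#
  -1*-1≈1 = F.trans (-1*x≈-x (- 1#)) (-‿involutive 1#)

  sgn-* : ∀ n → sgn n * sgn n ≈ 1#
  sgn-* n = F.trans (F.sym (^-* (- 1#) (- 1#) n)) (F.trans (^-cong n -1*-1≈1) (1^ n))

  neg-^ : ∀ x n → (- x) ^ᶠ n ≈ sgn n * x ^ᶠ n
  neg-^ x n = F.trans (^-cong n (F.sym (-1*x≈-x x))) (^-* (- 1#) x n)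

  Π-blockSizes : ∀ c s → Π F (map c (blockSizes s)) ≈ multiplicative c s
  Π-blockSizes c s = F.trans
    (F.reflexive (≡.cong (Π F) (≡.sym (Listₚ.map-∘ (upTo (nBlocks s))))))
    (Π-upTo (nBlocks s) _)

  -- No block of a partition of n exceeds n. Agreement up to n has to suffice, since the identities
  -- for ⊠ are given up to degree d.
  cumulant-cong-≤ : ∀ {α β} n → (∀ k → k ≤ n → α k ≈ β k) → cumulant α n ≈ cumulant β n
  cumulant-cong-≤ n p = ∑-cong (P n) λ s s∈ → *-congˡ (∏<-cong (nBlocks s) λ j _ →
    p (count j s) (≡.subst (count j s ≤_) (growth-length (∈-partsFrom n 0 s∈)) (count≤length j s)))

  -- Newton's identities

  powerSum : List Carrier → ℕ → Carrier
  powerSum xs n = Σ F (map (λ x → x ^ᶠ n) xs)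

  factorialEsym : List Carrier → Seq
  factorialEsym xs k = ι (k !) * esymL F xs k

  -- The logarithm of the generating function ∏ (1 + xt) of factorialEsym.
  newtonCumulant : List Carrier → Seq
  newtonCumulant xs zero    = 0#
  newtonCumulant xs (suc k) = (sgn k * ι (k !)) * powerSum xs (suc k)

  esym-zero : ∀ xs → esymL F xs 0 ≈ 1#
  esym-zero []      = F.refl
  esym-zero (_ ∷ _) = F.refl

  -- The generating function 1 + x t of a single root.
  linear : Carrier → Seq
  linear x zero    = 1#
  linear x (suc n) = (x · δ) n

  linear-⋆-suc : ∀ x g n → (linear x ⋆ g) (suc n) ≈ g (suc n) + ι (suc n) * (x * g n)
  linear-⋆-suc x g n = F.trans (+-cong (F.trans (⋆-·ˡ x δ g n) (*-congˡ (⋆-identityˡ g n))) (rest n))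
    (solve 4 (λ a b i y → y :+ (a :+ i :* y) := a :+ (con 1 :+ i) :* y) F.refl (g (suc n)) x (ι n) (x * g n))
    where
    rest : ∀ n → (linear x ⋆ ∂ g) n ≈ g (suc n) + ι n * (x * g n)
    rest zero    = F.trans (*-identityˡ _) (F.sym (F.trans (+-congˡ (zeroˡ _)) (+-identityʳ _)))
    rest (suc n) = linear-⋆-suc x (∂ g) n

  factorialEsym-∷ : ∀ x xs → factorialEsym (x ∷ xs) ≋ linear x ⋆ factorialEsym xs
  factorialEsym-∷ x xs zero = F.trans (*-congˡ (F.sym (esym-zero xs))) (F.sym (*-identityˡ _))
  factorialEsym-∷ x xs (suc n) = begin
    ι (suc n !) * (esymL F xs (suc n) + x * esymL F xs n)
      ≈⟨ distribˡ _ _ _ ⟩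
    ι (suc n !) * esymL F xs (suc n) + ι (suc n !) * (x * esymL F xs n)
      ≈⟨ +-congˡ (*-congʳ (ι-* (suc n) (n !))) ⟩
    ι (suc n !) * esymL F xs (suc n) + (ι (suc n) * ι (n !)) * (x * esymL F xs n)
      ≈⟨ +-congˡ (solve 4 (λ i f x e → (i :* f) :* (x :* e) := i :* (x :* (f :* e))) F.refl (ι (suc n)) (ι (n !)) x _) ⟩
    factorialEsym xs (suc n) + ι (suc n) * (x * factorialEsym xs n)
      ≈⟨ linear-⋆-suc x (factorialEsym xs) n ⟨
    (linear x ⋆ factorialEsym xs) (suc n) ∎

  -- The coefficients of x/(1 + x t), the derivative of log (1 + x t); the next lemma confirms this
  -- with the denominator cleared.
  logDerivative : Carrier → Seq
  logDerivative x n = (sgn n * ι (n !)) * x ^ᶠ suc n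

  linear-⋆-logDerivative : ∀ x → linear x ⋆ logDerivative x ≋ x · δ
  linear-⋆-logDerivative x zero =
    solve 1 (λ x → con 1 :* ((con 1 :* (con 1 :+ con 0)) :* (x :* con 1)) := x :* con 1) F.refl x
  linear-⋆-logDerivative x (suc n) = begin
    (linear x ⋆ logDerivative x) (suc n)
      ≈⟨ linear-⋆-suc x (logDerivative x) n ⟩
    (((- 1#) * sgn n) * ι (suc n !)) * (x * x ^ᶠ suc n) + ι (suc n) * (x * ((sgn n * ι (n !)) * x ^ᶠ suc n))
      ≈⟨ +-congʳ (*-congʳ (*-congˡ (ι-* (suc n) (n !)))) ⟩
    (((- 1#) * sgn n) * (ι (suc n) * ι (n !))) * (x * x ^ᶠ suc n) + ι (suc n) * (x * ((sgn n * ι (n !)) * x ^ᶠ suc n))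
      ≈⟨ solve 6 (λ e s i f x y → ((e :* s) :* (i :* f)) :* (x :* y) :+ i :* (x :* ((s :* f) :* y))
                    := (con 1 :+ e) :* (i :* (x :* ((s :* f) :* y)))) F.refl (- 1#) (sgn n) (ι (suc n)) (ι (n !)) x (x ^ᶠ suc n) ⟩
    (1# + - 1#) * (ι (suc n) * (x * ((sgn n * ι (n !)) * x ^ᶠ suc n)))
      ≈⟨ F.trans (*-congʳ (-‿inverseʳ 1#)) (zeroˡ _) ⟩
    0#
      ≈⟨ zeroʳ x ⟨
    x * 0# ∎

  -- Logarithmic derivatives add up over the roots: for G = (1 + x t) E with E′ = N E, one has G′ =
  -- x E + (1 + x t) N E = (x/(1 + x t) + N) G.
  newton-identity : ∀ xs → ∂ (factorialEsym xs) ≋ ∂ (newtonCumulant xs) ⋆ factorialEsym xs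
  newton-identity [] n = begin
    ι (suc n !) * 0#   ≈⟨ zeroʳ _ ⟩
    0#                 ≈⟨ ⋆-zeroˡ (factorialEsym []) n ⟨
    (𝟘 ⋆ factorialEsym []) n ≈⟨ ⋆-congʳ (λ _ → F.sym (zeroʳ _)) n ⟩
    (∂ (newtonCumulant []) ⋆ factorialEsym []) n ∎
  newton-identity (x ∷ xs) n = begin
    factorialEsym (x ∷ xs) (suc n)
      ≈⟨ factorialEsym-∷ x xs (suc n) ⟩
    ((x · δ) ⋆ E) n + (linear x ⋆ ∂ E) n
      ≈⟨ +-cong (⋆-congʳ (λ k → F.sym (linear-⋆-logDerivative x k)) n) (⋆-congˡ (newton-identity xs) n) ⟩
    ((linear x ⋆ logDerivative x) ⋆ E) n + (linear x ⋆ (N ⋆ E)) n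
      ≈⟨ +-cong (F.trans (⋆-congʳ (⋆-comm (linear x) (logDerivative x)) n) (⋆-assoc (logDerivative x) (linear x) E n))
                (⋆-swap (linear x) N E n) ⟩
    (logDerivative x ⋆ (linear x ⋆ E)) n + (N ⋆ (linear x ⋆ E)) n
      ≈⟨ ⋆-distribʳ (logDerivative x) N (linear x ⋆ E) n ⟨
    ((logDerivative x ⊕ N) ⋆ (linear x ⋆ E)) n
      ≈⟨ ⋆-cong (λ k → F.sym (distribˡ _ _ _)) (λ k → F.sym (factorialEsym-∷ x xs k)) n ⟩
    (∂ (newtonCumulant (x ∷ xs)) ⋆ factorialEsym (x ∷ xs)) n ∎
    where
    E N : Seq
    E = factorialEsym xs
    N = ∂ (newtonCumulant xs)

  expSeq-newtonCumulant : ∀ xs → expSeq (newtonCumulant xs) ≋ factorialEsym xs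
  expSeq-newtonCumulant xs = linear-ode-unique
    (F.trans (expSeq-zero (newtonCumulant xs)) (F.sym (F.trans (*-cong (+-identityʳ 1#) (esym-zero xs)) (*-identityˡ 1#))))
    (∂-expSeq (newtonCumulant xs)) (newton-identity xs)

  -- Distributing the Möbius function over blocks

  möbius-scaling-list : ∀ d D g c ks →
    All (λ k → 0 < k × ι d * (sgn (k ∸ 1) * ι ((k ∸ 1) !)) * g k ≈ D ^ᶠ k * c k) ks →
    length ks ≤ sum ks ×
    ι d ^ᶠ length ks * (sgn (sum ks ∸ length ks) * ι (prodℕ (map (λ k → (k ∸ 1) !) ks))) * Π F (map g ks)
      ≈ D ^ᶠ sum ks * Π F (map c ks)
  möbius-scaling-list d D g c [] [] = z≤n ,
    solve 0 (con 1 :* (con 1 :* (con 1 :+ con 0)) :* con 1 := con 1 :* con 1) F.refl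
  möbius-scaling-list d D g c (suc k ∷ ks) ((_ , e) ∷ es) with möbius-scaling-list d D g c ks es
  -- `le` makes `sum ks ∸ length ks` a true difference, so that the contribution k of the first
  -- block splits off the exponent of the sign.
  ... | le , ih = s≤s (ℕₚ.≤-trans le (ℕₚ.m≤n+m (sum ks) k)) , (begin
    ι d * ι d ^ᶠ length ks * (sgn (k ℕ.+ sum ks ∸ length ks) * ι (k ! ℕ.* f)) * (g (suc k) * G)
      ≈⟨ *-congʳ (*-congˡ (*-cong (F.trans (F.reflexive (≡.cong sgn (ℕₚ.+-∸-assoc k le))) (^-+ (- 1#) k _)) (ι-* (k !) f))) ⟩
    ι d * ι d ^ᶠ length ks * ((sgn k * sgn (sum ks ∸ length ks)) * (ι (k !) * ι f)) * (g (suc k) * G)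
      ≈⟨ solve 8 (λ a b s t x y u v → a :* b :* ((s :* t) :* (x :* y)) :* (u :* v)
                    := (a :* (s :* x) :* u) :* (b :* (t :* y) :* v))
           F.refl (ι d) (ι d ^ᶠ length ks) (sgn k) (sgn (sum ks ∸ length ks)) (ι (k !)) (ι f) (g (suc k)) G ⟩
    (ι d * (sgn k * ι (k !)) * g (suc k)) * (ι d ^ᶠ length ks * (sgn (sum ks ∸ length ks) * ι f) * G)
      ≈⟨ *-cong e ih ⟩
    (D ^ᶠ suc k * c (suc k)) * (D ^ᶠ sum ks * Π F (map c ks))
      ≈⟨ solve 4 (λ a b x y → (a :* b) :* (x :* y) := (a :* x) :* (b :* y)) F.refl (D ^ᶠ suc k) (c (suc k)) _ _ ⟩
    (D ^ᶠ suc k * D ^ᶠ sum ks) * (c (suc k) * Π F (map c ks))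
      ≈⟨ *-congʳ (^-+ D (suc k) (sum ks)) ⟨
    D ^ᶠ (suc k ℕ.+ sum ks) * (c (suc k) * Π F (map c ks)) ∎)
    where
    f = prodℕ (map (λ k → (k ∸ 1) !) ks)
    G = Π F (map g ks)

  -- With μ(0ₙ,σ) distributed over the blocks, d^|σ| μ(0ₙ,σ) g_σ = Dⁿ c_σ follows from its
  -- instance for a single block.
  möbius-scaling : ∀ d D g c n →
    (∀ k → suc k ≤ n → ι d * (sgn k * ι (k !)) * g (suc k) ≈ D ^ᶠ suc k * c (suc k)) →
    ∀ {σ} → σ ∈ P n →
    ι d ^ᶠ nBlocks σ * möbius F n σ * Π F (map g (blockSizes σ)) ≈ D ^ᶠ n * multiplicative c σ
  möbius-scaling d D g c n h {σ} σ∈ = begin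
    ι d ^ᶠ nBlocks σ * möbius F n σ * Π F (map g (blockSizes σ))
      ≡⟨ ≡.cong₂ (λ b k → ι d ^ᶠ b * (sgn (k ∸ b) * ι (prodℕ (map (λ i → (i ∸ 1) !) (blockSizes σ))))
                             * Π F (map g (blockSizes σ))) (length-blockSizes σ) sum≡n ⟨
    _
      ≈⟨ proj₂ (möbius-scaling-list d D g c (blockSizes σ) (All.map block (blockSizes-bounds gs))) ⟩
    D ^ᶠ sum (blockSizes σ) * Π F (map c (blockSizes σ))
      ≈⟨ *-cong (F.reflexive (≡.cong (D ^ᶠ_) sum≡n)) (Π-blockSizes c σ) ⟩
    D ^ᶠ n * multiplicative c σ ∎
    where
    gs = ∈-partsFrom n 0 σ∈
    sum≡n : sum (blockSizes σ) ≡ n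
    sum≡n = ≡.trans (sum-blockSizes σ) (growth-length gs)
    block : ∀ {k} → 0 < k × k ≤ n → 0 < k × ι d * (sgn (k ∸ 1) * ι ((k ∸ 1) !)) * g k ≈ D ^ᶠ k * c k
    block {suc k} (0<k , k≤n) = 0<k , h k k≤n

  Σ≡∑ : ∀ xs → Σ F xs ≡ ∑ xs id
  Σ≡∑ xs = ≡.cong (Σ F) (≡.sym (Listₚ.map-id xs))

  Σ-concatMap : ∀ {A : Set} (h : A → List Carrier) xs → Σ F (concatMap h xs) ≈ ∑ xs (Σ F ∘ h)
  Σ-concatMap h xs = begin
    Σ F (concatMap h xs)      ≡⟨ Σ≡∑ (concatMap h xs) ⟩
    ∑ (concatMap h xs) id     ≈⟨ ∑-concatMap h xs id ⟩
    ∑ xs (λ x → ∑ (h x) id)   ≈⟨ ∑-cong xs (λ x _ → F.reflexive (≡.sym (Σ≡∑ (h x)))) ⟩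
    ∑ xs (Σ F ∘ h)            ∎

  Σ-if : ∀ b x → Σ F (if b then x ∷ [] else []) ≈ [ b ] * x
  Σ-if true  x = F.trans (+-identityʳ x) (F.sym (*-identityˡ x))
  Σ-if false x = F.sym (zeroˡ x)

  -- Finite free cumulants, moments and the convolution

  module _ {d : ℕ} {{d≢0 : NonZero d}} where

    -- The sequence α_k = k! a_k / (d)_k, whose cumulants are rescaled finite free cumulants.
    record Normalised (λs : Vec Carrier d) (α : Seq) : Set ℓ where
      constructor normalised
      field
        -- A relation rather than a formula for `α`: it fixes `α` up to d, where (d)_k ≠ 0, and so
        -- lets the product of two normalised sequences represent p ⊠ q.
        scale : ∀ k → k ≤ d → ι (d ↓ k) * α k ≈ coeff F λs k * ι (k !)
    open Normalised

    prodP≢0 : ∀ ks → All (_≤ d) ks → NonZero (prodℕ (map (d ↓_) ks))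
    prodP≢0 []       []       = _
    prodP≢0 (k ∷ ks) (p ∷ ps) = ℕₚ.m*n≢0 (d ↓ k) _ {{nPk≢0 p}} {{prodP≢0 ks ps}}

    Π-normalised : ∀ {λs α} → Normalised λs α → ∀ ks → All (_≤ d) ks →
      ι (prodℕ (map (d ↓_) ks)) * Π F (map α ks) ≈ ι (prodℕ (map _! ks)) * Π F (map (coeff F λs) ks)
    Π-normalised N [] [] = F.refl
    Π-normalised {λs} {α} N (k ∷ ks) (p ∷ ps) = begin
      ι ((d ↓ k) ℕ.* A) * (α k * Π F (map α ks))
        ≈⟨ *-congʳ (ι-* (d ↓ k) A) ⟩
      (ι (d ↓ k) * ι A) * (α k * Π F (map α ks))
        ≈⟨ solve 4 (λ a b x y → (a :* b) :* (x :* y) := (a :* x) :* (b :* y)) F.refl (ι (d ↓ k)) (ι A) (α k) _ ⟩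
      (ι (d ↓ k) * α k) * (ι A * Π F (map α ks))
        ≈⟨ *-cong (scale N k p) (Π-normalised N ks ps) ⟩
      (coeff F λs k * ι (k !)) * (ι B * Π F (map (coeff F λs) ks))
        ≈⟨ solve 4 (λ a b x y → (a :* b) :* (x :* y) := (b :* x) :* (a :* y)) F.refl (coeff F λs k) (ι (k !)) (ι B) _ ⟩
      (ι (k !) * ι B) * (coeff F λs k * Π F (map (coeff F λs) ks))
        ≈⟨ *-congʳ (ι-* (k !) B) ⟨
      ι (k ! ℕ.* B) * (coeff F λs k * Π F (map (coeff F λs) ks)) ∎
      where
      A = prodℕ (map (d ↓_) ks)
      B = prodℕ (map _! ks)

    -- The factor -1 appears because κ carries the sign (-1)^|π|, whereas μ(π,1ₙ) carries
    -- (-1)^(|π|-1).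
    kappa-cumulant : ∀ {λs α} → Normalised λs α → ∀ n → suc n ≤ d →
      kappa F λs (suc n) ≈ (((- ι d) ^ᶠ suc n) ÷ (d ℕ.* n !)) * ((- 1#) * cumulant α (suc n))
    kappa-cumulant {λs} {α} N n n<d = *-congˡ (F.trans
      (∑-cong (P (suc n)) summand) (F.sym (∑-*ˡ (P (suc n)) (- 1#) _)))
      where
      summand : ∀ π → π ∈ P (suc n) →
        ((sgn (nBlocks π) * ι (prodℕ (map _! (blockSizes π)))) * coeffπ F λs π * ι ((nBlocks π ∸ 1) !))
          ÷ prodℕ (map (d ↓_) (blockSizes π))
        ≈ (- 1#) * (möbiusWeight (nBlocks π) * multiplicative α π)
      summand []         π∈ with () ← growth-length (∈-partsFrom (suc n) 0 π∈)
      summand π@(x ∷ s) π∈ = ÷-unique Q {{prodP≢0 ks ks≤d}} (begin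
        ι Q * ((- 1#) * ((sgn b * ι (b !)) * multiplicative α π))
          ≈⟨ *-congˡ (*-congˡ (*-congˡ (Π-blockSizes α π))) ⟨
        ι Q * ((- 1#) * ((sgn b * ι (b !)) * Π F (map α ks)))
          ≈⟨ solve 5 (λ q e s f y → q :* (e :* ((s :* f) :* y)) := (e :* s) :* f :* (q :* y))
               F.refl (ι Q) (- 1#) (sgn b) (ι (b !)) _ ⟩
        ((- 1#) * sgn b) * ι (b !) * (ι Q * Π F (map α ks))
          ≈⟨ *-congˡ (Π-normalised N ks ks≤d) ⟩
        ((- 1#) * sgn b) * ι (b !) * (ι R * Π F (map (coeff F λs) ks))
          ≈⟨ solve 4 (λ s f r y → s :* f :* (r :* y) := (s :* r) :* y :* f) F.refl ((- 1#) * sgn b) (ι (b !)) (ι R) _ ⟩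
        (((- 1#) * sgn b) * ι R) * coeffπ F λs π * ι (b !) ∎)
        where
        ks = blockSizes π
        b = nBlocks π ∸ 1
        Q = prodℕ (map (d ↓_) ks)
        R = prodℕ (map _! ks)
        ks≤d : All (_≤ d) ks
        ks≤d = All.map (λ (_ , k≤n) → ℕₚ.≤-trans k≤n n<d) (blockSizes-bounds (∈-partsFrom (suc n) 0 π∈))

    -- The one-block instance for `möbius-scaling` with D = d. All signs cancel in pairs, and d k!
    -- cancels the denominator of κ.
    kappa-scaling : ∀ {λs α} → Normalised λs α → ∀ k → suc k ≤ d →
      ι d * (sgn k * ι (k !)) * kappa F λs (suc k) ≈ ι d ^ᶠ suc k * cumulant α (suc k)
    kappa-scaling {λs} {α} N k k<d = begin
      ι d * (sgn k * ι (k !)) * kappa F λs (suc k)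
        ≈⟨ *-congˡ (kappa-cumulant N k k<d) ⟩
      ι d * (sgn k * ι (k !)) * (((- ι d) ^ᶠ suc k * I) * ((- 1#) * C))
        ≈⟨ *-congˡ (*-congʳ (*-congʳ (neg-^ (ι d) (suc k)))) ⟩
      ι d * (sgn k * ι (k !)) * ((((- 1#) * sgn k) * D * I) * ((- 1#) * C))
        ≈⟨ solve 7 (λ d s f e D I C → d :* (s :* f) :* (((e :* s) :* D :* I) :* (e :* C))
                      := (s :* s) :* (e :* e) :* ((d :* f) :* I) :* (D :* C))
             F.refl (ι d) (sgn k) (ι (k !)) (- 1#) D I C ⟩
      (sgn k * sgn k) * ((- 1#) * (- 1#)) * ((ι d * ι (k !)) * I) * (D * C)
        ≈⟨ *-congʳ (*-cong (*-cong (sgn-* k) -1*-1≈1) (F.trans (*-congʳ (F.sym (ι-* d (k !))))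
             (ι-inverseʳ (d ℕ.* k !) {{ℕₚ.m*n≢0 d (k !) {{d≢0}} {{k ℕₚ.!≢0}}}}))) ⟩
      1# * 1# * 1# * (D * C)
        ≈⟨ solve 1 (λ x → con 1 :* con 1 :* con 1 :* x := x) F.refl (D * C) ⟩
      D * C ∎
      where
      I = inv (ι (d ℕ.* k !))
      C = cumulant α (suc k)
      D = ι d ^ᶠ suc k

    -- The one-block instance with D = 1, since moments carry no power (-d)ⁿ as κ does.
    moment-scaling : ∀ (λs : Vec Carrier d) k →
      ι d * (sgn k * ι (k !)) * moment F λs (suc k) ≈ 1# ^ᶠ suc k * newtonCumulant (toList λs) (suc k)
    moment-scaling λs k = begin
      ι d * (sgn k * ι (k !)) * (p * inv (ι d))
        ≈⟨ solve 4 (λ d s p i → d :* s :* (p :* i) := (d :* i) :* (s :* p)) F.refl (ι d) (sgn k * ι (k !)) p (inv (ι d)) ⟩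
      (ι d * inv (ι d)) * ((sgn k * ι (k !)) * p)
        ≈⟨ *-congʳ (F.trans (ι-inverseʳ d) (F.sym (1^ (suc k)))) ⟩
      1# ^ᶠ suc k * ((sgn k * ι (k !)) * p) ∎
      where p = powerSum (toList λs) (suc k)

    -- Serves both formulas: `g` is κ of q with D = d, or the moments of q with D = 1. The powers
    -- leave the double sum because the block sizes of σ, and likewise of τ, add up to the same
    -- total.
    rhs-cumulant : ∀ {λs α} → Normalised λs α → ∀ D g c′ n → suc n ≤ d →
      (∀ k → suc k ≤ suc n → ι d * (sgn k * ι (k !)) * g (suc k) ≈ D ^ᶠ suc k * c′ (suc k)) →
      rhs F λs (λ τ → Π F (map g (blockSizes τ))) (suc n) ≈
      (sgn n ÷ (d ℕ.^ (suc n ℕ.+ 1) ℕ.* n !)) *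
        (ι d ^ᶠ suc n * D ^ᶠ suc n * cumulant (expSeq (cumulant α) ⊙ expSeq c′) (suc n))
    rhs-cumulant {λs} {α} N D g c′ n n<d h = *-congˡ (begin
      Σ F (concatMap (λ σ → concatMap (row σ) Ps) Ps)
        ≈⟨ Σ-concatMap (λ σ → concatMap (row σ) Ps) Ps ⟩
      ∑ Ps (λ σ → Σ F (concatMap (row σ) Ps))
        ≈⟨ ∑-cong Ps (λ σ _ → Σ-concatMap (row σ) Ps) ⟩
      ∑ Ps (λ σ → ∑ Ps (λ τ → Σ F (row σ τ)))
        ≈⟨ ∑-cong Ps (λ σ σ∈ → ∑-cong Ps (λ τ τ∈ → entry σ τ σ∈ τ∈)) ⟩
      ∑ Ps (λ σ → ∑ Ps (λ τ → K * J σ τ))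
        ≈⟨ ∑-cong Ps (λ σ _ → ∑-*ˡ Ps K (J σ)) ⟨
      ∑ Ps (λ σ → K * ∑ Ps (J σ))
        ≈⟨ ∑-*ˡ Ps K _ ⟨
      K * ∑ Ps (λ σ → ∑ Ps (J σ))
        ≈⟨ *-congˡ (∑-join-one n κ c′) ⟩
      K * cumulant (expSeq κ ⊙ expSeq c′) (suc n) ∎)
      where
      Ps = P (suc n)
      K = ι d ^ᶠ suc n * D ^ᶠ suc n
      κ = cumulant α
      J : List ℕ → List ℕ → Carrier
      J σ τ = [ joinIsOne (suc n) σ τ ] * (multiplicative κ σ * multiplicative c′ τ)
      X : List ℕ → List ℕ → Carrier
      X σ τ = (ι d ^ᶠ (nBlocks σ ℕ.+ nBlocks τ)) * möbius F (suc n) σ * möbius F (suc n) τ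
                * kappaπ F λs σ * Π F (map g (blockSizes τ))
      row : List ℕ → List ℕ → List Carrier
      row σ τ = if joinIsOne (suc n) σ τ then X σ τ ∷ [] else []
      entry : ∀ σ τ → σ ∈ Ps → τ ∈ Ps → Σ F (row σ τ) ≈ K * J σ τ
      entry σ τ σ∈ τ∈ = begin
        Σ F (row σ τ)
          ≈⟨ Σ-if (joinIsOne (suc n) σ τ) (X σ τ) ⟩
        j * X σ τ
          ≈⟨ *-congˡ (*-congʳ (*-congʳ (*-congʳ (*-congʳ (^-+ (ι d) (nBlocks σ) (nBlocks τ)))))) ⟩
        j * ((ι d ^ᶠ nBlocks σ * ι d ^ᶠ nBlocks τ) * möbius F (suc n) σ * möbius F (suc n) τ * kappaπ F λs σ * G)
          ≈⟨ *-congˡ (solve 6 (λ a b m μ k g → (a :* b) :* m :* μ :* k :* g := (a :* m :* k) :* (b :* μ :* g)) F.refl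
               (ι d ^ᶠ nBlocks σ) (ι d ^ᶠ nBlocks τ) (möbius F (suc n) σ) (möbius F (suc n) τ) (kappaπ F λs σ) G) ⟩
        j * ((ι d ^ᶠ nBlocks σ * möbius F (suc n) σ * kappaπ F λs σ) * (ι d ^ᶠ nBlocks τ * möbius F (suc n) τ * G))
          ≈⟨ *-congˡ (*-cong
               (möbius-scaling d (ι d) (kappa F λs) κ (suc n) (λ k k≤n → kappa-scaling N k (ℕₚ.≤-trans k≤n n<d)) σ∈)
               (möbius-scaling d D g c′ (suc n) h τ∈)) ⟩
        j * ((ι d ^ᶠ suc n * multiplicative κ σ) * (D ^ᶠ suc n * multiplicative c′ τ))
          ≈⟨ solve 5 (λ j a x b y → j :* ((a :* x) :* (b :* y)) := (a :* b) :* (j :* (x :* y)))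
               F.refl j (ι d ^ᶠ suc n) _ (D ^ᶠ suc n) _ ⟩
        K * J σ τ ∎
        where
        j = [ joinIsOne (suc n) σ τ ]
        G = Π F (map g (blockSizes τ))

    normalise : Vec Carrier d → Seq
    normalise λs k = (coeff F λs k * ι (k !)) ÷ (d ↓ k)

    normalise-Normalised : ∀ λs → Normalised λs (normalise λs)
    normalise-Normalised λs .scale k k≤d = ι-÷ (d ↓ k) {{nPk≢0 k≤d}} _

    normalise-zero : ∀ λs → normalise λs 0 ≈ 1#
    normalise-zero λs = ÷-unique 1 (begin
      ι 1 * 1#                        ≈⟨ *-comm (ι 1) 1# ⟩
      1# * ι 1                        ≈⟨ *-congʳ (esym-zero (toList λs)) ⟨
      coeff F λs 0 * ι 1              ∎)

    ι-↓ : ∀ {k} → k ≤ d → ι (d ↓ k) ≈ ι (k !) * ι (d C k)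
    ι-↓ {k} k≤d = F.trans (F.reflexive (≡.cong ι (≡.sym (nCk*k!≡nPk k≤d)))) (F.trans (ι-* (d C k) (k !)) (*-comm _ _))

    -- The power of d gained from σ turns d^(n+1) (n-1)! into d (n-1)!, the denominator of κ; the
    -- index n of the formulas is `suc n` here.
    prefactor : ∀ n → ι d ^ᶠ suc n * inv (ι (d ℕ.^ (suc n ℕ.+ 1) ℕ.* n !)) ≈ inv (ι (d ℕ.* n !))
    prefactor n = begin
      ι d ^ᶠ suc n * inv (ι (d ℕ.^ (suc n ℕ.+ 1) ℕ.* n !))
        ≈⟨ *-congʳ (ι-^ d (suc n)) ⟨
      ι (d ℕ.^ suc n) * inv (ι (d ℕ.^ (suc n ℕ.+ 1) ℕ.* n !))
        ≡⟨ ≡.cong (λ k → ι (d ℕ.^ suc n) * inv (ι k)) split ⟩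
      ι (d ℕ.^ suc n) * inv (ι (d ℕ.^ suc n ℕ.* (d ℕ.* n !)))
        ≈⟨ inv-* (d ℕ.^ suc n) (d ℕ.* n !) {{ℕₚ.m^n≢0 d (suc n)}} {{ℕₚ.m*n≢0 d (n !) {{d≢0}} {{n ℕₚ.!≢0}}}} ⟩
      inv (ι (d ℕ.* n !)) ∎
      where
      split : d ℕ.^ (suc n ℕ.+ 1) ℕ.* n ! ≡ d ℕ.^ suc n ℕ.* (d ℕ.* n !)
      split = ≡.trans (≡.cong (ℕ._* n !) (≡.trans (ℕₚ.^-distribˡ-+-* d (suc n) 1)
                          (≡.cong (d ℕ.^ suc n ℕ.*_) (ℕₚ.*-identityʳ d))))
                      (ℕₚ.*-assoc (d ℕ.^ suc n) d (n !))

    module _ (λp λq λpq : Vec Carrier d) (⊠ : IsBoxtimesRoots F λp λq λpq) where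

      ι-↓-coeff : ∀ k → k ≤ d → ι (d ↓ k) * coeff F λpq k ≈ ι (k !) * (coeff F λp k * coeff F λq k)
      ι-↓-coeff k k≤d = begin
        ι (d ↓ k) * coeff F λpq k
          ≈⟨ *-cong (ι-↓ k≤d) (⊠ k k≤d) ⟩
        (ι (k !) * ι (d C k)) * ((coeff F λp k * coeff F λq k) ÷ (d C k))
          ≈⟨ *-assoc _ _ _ ⟩
        ι (k !) * (ι (d C k) * ((coeff F λp k * coeff F λq k) ÷ (d C k)))
          ≈⟨ *-congˡ (ι-÷ (d C k) {{nCk≢0 k≤d}} _) ⟩
        ι (k !) * (coeff F λp k * coeff F λq k) ∎

      ⊠-Normalised : Normalised λpq (normalise λp ⊙ normalise λq)
      ⊠-Normalised .scale k k≤d = ι-cancelˡ (d ↓ k) {{nPk≢0 k≤d}} (begin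
        i * (i * (normalise λp k * normalise λq k))
          ≈⟨ solve 3 (λ i a b → i :* (i :* (a :* b)) := (i :* a) :* (i :* b)) F.refl i (normalise λp k) (normalise λq k) ⟩
        (i * normalise λp k) * (i * normalise λq k)
          ≈⟨ *-cong (scale (normalise-Normalised λp) k k≤d) (scale (normalise-Normalised λq) k k≤d) ⟩
        (coeff F λp k * ι (k !)) * (coeff F λq k * ι (k !))
          ≈⟨ solve 3 (λ a b f → (a :* f) :* (b :* f) := (f :* (a :* b)) :* f) F.refl (coeff F λp k) (coeff F λq k) (ι (k !)) ⟩
        (ι (k !) * (coeff F λp k * coeff F λq k)) * ι (k !)
          ≈⟨ *-congʳ (ι-↓-coeff k k≤d) ⟨
        (i * coeff F λpq k) * ι (k !)
          ≈⟨ *-assoc _ _ _ ⟩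
        i * (coeff F λpq k * ι (k !)) ∎)
        where i = ι (d ↓ k)

      -- For the moments just the factor of p is normalised: k!/(d)_k is the reciprocal of the
      -- binomial coefficient in ⊠, and the remaining k! is the one that Newton's identities call
      -- for.
      ⊠-factorialEsym : ∀ k → k ≤ d →
        normalise λp k * factorialEsym (toList λq) k ≈ factorialEsym (toList λpq) k
      ⊠-factorialEsym k k≤d = ι-cancelˡ (d ↓ k) {{nPk≢0 k≤d}} (begin
        i * (normalise λp k * (ι (k !) * coeff F λq k))
          ≈⟨ *-assoc _ _ _ ⟨
        (i * normalise λp k) * (ι (k !) * coeff F λq k)
          ≈⟨ *-congʳ (scale (normalise-Normalised λp) k k≤d) ⟩
        (coeff F λp k * ι (k !)) * (ι (k !) * coeff F λq k)
          ≈⟨ solve 3 (λ a b f → (a :* f) :* (f :* b) := f :* (f :* (a :* b))) F.refl (coeff F λp k) (coeff F λq k) (ι (k !)) ⟩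
        ι (k !) * (ι (k !) * (coeff F λp k * coeff F λq k))
          ≈⟨ *-congˡ (ι-↓-coeff k k≤d) ⟨
        ι (k !) * (i * coeff F λpq k)
          ≈⟨ solve 3 (λ f i a → f :* (i :* a) := i :* (f :* a)) F.refl (ι (k !)) i (coeff F λpq k) ⟩
        i * (ι (k !) * coeff F λpq k) ∎)
        where i = ι (d ↓ k)

      kappa-⊠ : ∀ n → suc n ≤ d → kappa F λpq (suc n) ≈ rhs F λp (kappaπ F λq) (suc n)
      kappa-⊠ n n<d = begin
        kappa F λpq (suc n)
          ≈⟨ kappa-cumulant ⊠-Normalised n n<d ⟩
        (((- ι d) ^ᶠ suc n) * inv (ι (d ℕ.* n !))) * ((- 1#) * C)
          -- `prefactor` is read backwards to create the second power of d. The sign taken out of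
          -- the power of -d and the -1 of `kappa-cumulant` leave `sgn n`.
          ≈⟨ *-congʳ (*-cong (neg-^ (ι d) (suc n)) (F.sym (prefactor n))) ⟩
        ((((- 1#) * sgn n) * D) * (D * I)) * ((- 1#) * C)
          ≈⟨ solve 5 (λ e s D I C → (((e :* s) :* D) :* (D :* I)) :* (e :* C) := (e :* e) :* ((s :* I) :* (D :* D :* C)))
               F.refl (- 1#) (sgn n) D I C ⟩
        ((- 1#) * (- 1#)) * ((sgn n * I) * (D * D * C))
          ≈⟨ F.trans (*-congʳ -1*-1≈1) (*-identityˡ _) ⟩
        (sgn n * I) * (D * D * C)
          ≈⟨ *-congˡ (*-congˡ (cumulant-cong-≤ (suc n) λ k _ → *-cong
               (expSeq-cumulant (normalise λp) (normalise-zero λp) k)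
               (expSeq-cumulant (normalise λq) (normalise-zero λq) k))) ⟨
        (sgn n * I) * (D * D * cumulant (expSeq (cumulant (normalise λp)) ⊙ expSeq (cumulant (normalise λq))) (suc n))
          ≈⟨ rhs-cumulant (normalise-Normalised λp) (ι d) (kappa F λq) (cumulant (normalise λq)) n n<d
               (λ k k≤n → kappa-scaling (normalise-Normalised λq) k (ℕₚ.≤-trans k≤n n<d)) ⟨
        rhs F λp (kappaπ F λq) (suc n) ∎
        where
        C = cumulant (normalise λp ⊙ normalise λq) (suc n)
        D = ι d ^ᶠ suc n
        I = inv (ι (d ℕ.^ (suc n ℕ.+ 1) ℕ.* n !))

      moment-⊠ : ∀ n → suc n ≤ d → moment F λpq (suc n) ≈ rhs F λp (momentπ F λq) (suc n)
      moment-⊠ n n<d = F.sym (begin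
        rhs F λp (momentπ F λq) (suc n)
          ≈⟨ rhs-cumulant (normalise-Normalised λp) 1# (moment F λq) (newtonCumulant (toList λq)) n n<d
               (λ k _ → moment-scaling λq k) ⟩
        (sgn n * I) * (D * 1# ^ᶠ suc n * cumulant (expSeq (cumulant (normalise λp)) ⊙ expSeq (newtonCumulant (toList λq))) (suc n))
          ≈⟨ *-congˡ (*-cong (*-congˡ (1^ (suc n))) cumulants) ⟩
        (sgn n * I) * (D * 1# * ((sgn n * ι (n !)) * p))
          ≈⟨ solve 5 (λ s I D f p → (s :* I) :* (D :* con 1 :* ((s :* f) :* p)) := (s :* s) :* (p :* (f :* (D :* I))))
               F.refl (sgn n) I D (ι (n !)) p ⟩
        (sgn n * sgn n) * (p * (ι (n !) * (D * I)))
          ≈⟨ F.trans (*-congʳ (sgn-* n)) (*-identityˡ _) ⟩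
        p * (ι (n !) * (D * I))
          ≈⟨ *-congˡ (*-congˡ (F.trans (prefactor n) (F.reflexive (≡.cong (λ k → inv (ι k)) (ℕₚ.*-comm d (n !)))))) ⟩
        p * (ι (n !) * inv (ι (n ! ℕ.* d)))
          ≈⟨ *-congˡ (inv-* (n !) d {{n ℕₚ.!≢0}}) ⟩
        p * inv (ι d) ∎)
        where
        p = powerSum (toList λpq) (suc n)
        D = ι d ^ᶠ suc n
        I = inv (ι (d ℕ.^ (suc n ℕ.+ 1) ℕ.* n !))
        cumulants : cumulant (expSeq (cumulant (normalise λp)) ⊙ expSeq (newtonCumulant (toList λq))) (suc n)
                    ≈ newtonCumulant (toList λpq) (suc n)
        cumulants = begin
          cumulant (expSeq (cumulant (normalise λp)) ⊙ expSeq (newtonCumulant (toList λq))) (suc n)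
            ≈⟨ cumulant-cong-≤ (suc n) (λ k k≤n → begin
                 expSeq (cumulant (normalise λp)) k * expSeq (newtonCumulant (toList λq)) k
                   ≈⟨ *-cong (expSeq-cumulant (normalise λp) (normalise-zero λp) k) (expSeq-newtonCumulant (toList λq) k) ⟩
                 normalise λp k * factorialEsym (toList λq) k
                   ≈⟨ ⊠-factorialEsym k (ℕₚ.≤-trans k≤n n<d) ⟩
                 factorialEsym (toList λpq) k
                   ≈⟨ expSeq-newtonCumulant (toList λpq) k ⟨
                 expSeq (newtonCumulant (toList λpq)) k ∎) ⟩
          cumulant (expSeq (newtonCumulant (toList λpq))) (suc n)
            ≈⟨ cumulant-expSeq (newtonCumulant (toList λpq)) n ⟩
          newtonCumulant (toList λpq) (suc n) ∎

theorem1p1 : {c ℓ : Level} (F : CharZeroField c ℓ) →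
    let open CharZeroField F in
    (d : ℕ) → 1 ≤ d →
    (λp λq λpq : Vec Carrier d) → IsBoxtimesRoots F λp λq λpq →
    (n : ℕ) → 1 ≤ n → n ≤ d →
    (kappa F λpq n ≈ rhs F λp (kappaπ F λq) n)
    × (moment F λpq n ≈ rhs F λp (momentπ F λq) n)
theorem1p1 F (suc d) _ λp λq λpq ⊠ (suc n) _ n<d = kappa-⊠ λp λq λpq ⊠ n n<d , moment-⊠ λp λq λpq ⊠ n n<d
  where open FiniteFree F
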